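{- Fix an integer $k\geq 2$ and a nonempty (finite or infinite) sequence of permutation patterns $\tau^{(1)},\tau^{(2)},\ldots$, where each $\tau^{(i)}\in S_{m_i}$ for some $m_i\ge 1$. If the permutations $\tau^{(1)},\tau^{(2)},\ldots$ are all sum indecomposable, then the two limits below exist and $$\lim_{n\to\infty}|\mathrm{Av}_n(\tau^{(1)},\tau^{(2)},\ldots)|^{1/n}=\lim_{n\to\infty}|\mathcal H_n^k(\tau^{(1)},\tau^{(2)},\ldots)|^{1/n}.$$
   Context: $S_n$ is the set of permutations of $[n]=\{1,\ldots,n\}$, written as words in one-line notation. A permutation $\sigma=\sigma_1\cdots\sigma_n$ contains the pattern $\tau=\tau_1\cdots\tau_m\in S_m$ if there are indices $i_1<\cdots<i_m$ in $[n]$ such that for all $j,l\in[m]$ one has $\sigma_{i_j}<\sigma_{i_l}$ if and only if $\tau_j<\tau_l$; otherwise $\sigma$ avoids $\tau$. $\mathrm{Av}_n(\tau^{(1)},\tau^{(2)},\ldots)$ is the set of permutations in $S_n$ that avoid all of the patterns $\tau^{(1)},\tau^{(2)},\ldots$. For $\lambda\in S_\ell$ and $\mu\in S_m$ (with $\ell,m\ge 1$), the direct sum $\lambda\oplus\mu\in S_{\ell+m}$ is given by $(\lambda\oplus\mu)_i=\lambda_i$ for $1\le i\le \ell$ and $(\lambda\oplus\mu)_i=\mu_{i-\ell}+\ell$ for $\ell+1\le i\le \ell+m$. A permutation is sum indecomposable if it cannot be written as the direct sum of two shorter permutations. A complete $k$-ary tree is a rooted tree in which every vertex not in the penultimate or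 last level has exactly $k$ children and all vertices in the last level are as far left as possible. Equivalently, if $v_1,\ldots,v_n$ are the vertices in breadth-first order (starting from the root, level by level, each level from left to right), then the children of $v_i$ are those $v_j$ with $k(i-1)+2\le j\le ki+1$ and $j\le n$. For each $n$ there is exactly one complete $k$-ary tree with $n$ vertices. An $n$-vertex $k$-ary heap is a bijective labeling of the vertices of this tree by $[n]$ such that each vertex has a label smaller than the labels of its children. The permutation associated to a $k$-ary heap is the permutation in $S_n$ obtained by reading the labels of $v_1,v_2,\ldots,v_n$ in this order. $\mathcal H_n^k(\tau^{(1)},\tau^{(2)},\ldots)$ is the set of $n$-vertex $k$-ary heaps whose associated permutations avoid all of the patterns $\tau^{(1)},\tau^{(2)},\ldots$. -}

module Defs where

open import Data.Fin using (Fin; toℕ)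
import Data.Fin as Fin
open import Data.Fin.Permutation using (Permutation′; _⟨$⟩ʳ_; _≈_)
open import Data.Fin.Properties using (+↔⊎)
import Data.Integer as ℤ
open import Data.Nat using (ℕ; zero; suc; NonZero)
import Data.Nat as ℕ
open import Data.Product using (Σ-syntax; ∃; ∃-syntax; _×_; _,_; proj₁)
open import Data.Rational hiding (NonZero)
open import Data.Rational.Properties
open import Data.Sum using (_⊎_; inj₁; inj₂)
open import Data.Sum.Function.Propositional using (_⊎-↔_)
open import Function using (_∘_; _⇔_; mk⇔; Inverse)
open import Function.Construct.Composition using (_↔-∘_)
open import Function.Construct.Symmetry using (↔-sym)
open import Level using (0ℓ)
open import Relation.Binary.Bundles using (Setoid)
import Relation.Binary.Construct.On as On
open import Relation.Binary.Definitions using (tri<; tri≈; tri>)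
open import Relation.Binary.PropositionalEquality
  using (_≡_; refl; sym; trans; cong; subst; subst₂; setoid; _→-setoid_)
open import Relation.Nullary using (¬_; yes; no; contradiction)

open import Algebra.Definitions.RawSemiring +-*-rawSemiring using (_^_) public

------------------------------------------------------------------------
-- Permutations and patterns

-- Positions and values are 0-based: S_n is Permutation′ n, with equality
-- _≈_, and σ ⟨$⟩ʳ i is the entry at position i of the word of σ.

record Occurrence {m n} (τ : Permutation′ m) (σ : Permutation′ n) : Set where
  field
    position   : Fin m → Fin n
    increasing : ∀ {j l} → j Fin.< l → position j Fin.< position l
    sameOrder  : ∀ j l → (σ ⟨$⟩ʳ position j) Fin.< (σ ⟨$⟩ʳ position l)
                           ⇔ (τ ⟨$⟩ʳ j) Fin.< (τ ⟨$⟩ʳ l)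

record Pattern : Set where
  field
    size          : ℕ
    .{{nonEmpty}} : NonZero size
    perm          : Permutation′ size

open Pattern public

data SeqLength : Set where
  finite   : (r : ℕ) .{{_ : NonZero r}} → SeqLength
  infinite : SeqLength

Index : SeqLength → Set
Index (finite r) = Fin r
Index infinite   = ℕ

PatternSeq : SeqLength → Set
PatternSeq s = Index s → Pattern

Avoids : ∀ {s n} → PatternSeq s → Permutation′ n → Set
Avoids τ σ = ∀ i → ¬ Occurrence (perm (τ i)) σ

------------------------------------------------------------------------
-- Direct sums

infixl 7 _⊕_

-- A position i < ℓ goes to α i, and a position ℓ + j goes to ℓ + β j.
_⊕_ : ∀ {ℓ m} → Permutation′ ℓ → Permutation′ m → Permutation′ (ℓ ℕ.+ m)
_⊕_ {ℓ} {m} α β = ↔-sym (+↔⊎ {ℓ} {m}) ↔-∘ ((α ⊎-↔ β) ↔-∘ +↔⊎ {ℓ} {m})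

data SumDecomposable : ∀ {n} → Permutation′ n → Set where
  decompose : ∀ {ℓ m} .{{_ : NonZero ℓ}} .{{_ : NonZero m}}
              (α : Permutation′ ℓ) (β : Permutation′ m)
              {σ : Permutation′ (ℓ ℕ.+ m)} →
              σ ≈ α ⊕ β → SumDecomposable σ

SumIndecomposable : ∀ {n} → Permutation′ n → Set
SumIndecomposable σ = ¬ SumDecomposable σ

------------------------------------------------------------------------
-- Heaps

-- The vertices of the complete k-ary tree are numbered in breadth-first
-- order, the element i of Fin n being the vertex v_(1 + i).
IsChild : ∀ {n} → ℕ → (parent child : Fin n) → Set
IsChild k i j = k ℕ.* toℕ i ℕ.+ 2 ℕ.≤ suc (toℕ j)
              × suc (toℕ j) ℕ.≤ k ℕ.* suc (toℕ i) ℕ.+ 1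

-- A labelling of the vertices, listed in breadth-first order, is the same
-- thing as its associated permutation.
IsHeap : ∀ {n} → ℕ → Permutation′ n → Set
IsHeap k σ = ∀ i j → IsChild k i j → (σ ⟨$⟩ʳ i) Fin.< (σ ⟨$⟩ʳ j)

------------------------------------------------------------------------
-- Sets of permutations and their cardinality

PermsWith : ∀ n → (Permutation′ n → Set) → Setoid 0ℓ 0ℓ
PermsWith n P =
  On.setoid {B = Σ[ σ ∈ Permutation′ n ] P σ}
            (Fin n →-setoid Fin n) (λ x → proj₁ x ⟨$⟩ʳ_)

Av : ∀ {s} → ℕ → PatternSeq s → Setoid 0ℓ 0ℓ
Av n τ = PermsWith n (Avoids τ)

𝓗 : ∀ {s} → (k n : ℕ) → PatternSeq s → Setoid 0ℓ 0ℓ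
𝓗 k n τ = PermsWith n (λ σ → IsHeap k σ × Avoids τ σ)

HasCardinality : Setoid 0ℓ 0ℓ → ℕ → Set
HasCardinality S c = Inverse S (setoid (Fin c))

------------------------------------------------------------------------
-- Real numbers

-- Two-sided Dedekind cuts: Lower q means q < x, Upper q means x < q.
record ℝ : Set₁ where
  field
    Lower Upper     : ℚ → Set
    lower-inhabited : ∃ Lower
    upper-inhabited : ∃ Upper
    lower-rounded   : ∀ p → Lower p ⇔ (∃[ q ] p < q × Lower q)
    upper-rounded   : ∀ q → Upper q ⇔ (∃[ p ] p < q × Upper p)
    disjoint        : ∀ q → ¬ (Lower q × Upper q)
    located         : ∀ p q → p < q → Lower p ⊎ Upper q

open ℝ public

infix 4 _≃ᴿ_ _<_+ᴿ_ ∣_-_∣<_ _⟶_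

_≃ᴿ_ : ℝ → ℝ → Set
x ≃ᴿ y = ∀ q → (Lower x q ⇔ Lower y q) × (Upper x q ⇔ Upper y q)

-- x < y + ε, as x < q and q - ε < y for some rational q.
_<_+ᴿ_ : ℝ → ℝ → ℚ → Set
x < y +ᴿ ε = ∃[ q ] Upper x q × Lower y (q - ε)

∣_-_∣<_ : ℝ → ℝ → ℚ → Set
∣ x - y ∣< ε = (x < y +ᴿ ε) × (y < x +ᴿ ε)

-- Sequences start at index 1, since an n-th root is not defined at n = 0.
RealSeq : Set₁
RealSeq = ∀ n .{{_ : NonZero n}} → ℝ

_⟶_ : RealSeq → ℝ → Set
x ⟶ L = ∀ ε → 0ℚ < ε →
        ∃[ N ] (∀ n .{{_ : NonZero n}} → N ℕ.≤ n → ∣ x n - L ∣< ε)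

------------------------------------------------------------------------
-- Powers of rationals

private
  variable
    p q x y a b : ℚ

0≤* : 0ℚ ≤ x → 0ℚ ≤ y → 0ℚ ≤ x * y
0≤* {x} {y} 0≤x 0≤y = nonNegative⁻¹ (x * y)
  {{nonNeg*nonNeg⇒nonNeg x {{nonNegative 0≤x}} y {{nonNegative 0≤y}}}}

0<* : 0ℚ < x → 0ℚ < y → 0ℚ < x * y
0<* {x} {y} 0<x 0<y = positive⁻¹ (x * y)
  {{pos*pos⇒pos x {{positive 0<x}} y {{positive 0<y}}}}

*-monoˡ : 0ℚ ≤ x → p ≤ q → x * p ≤ x * q
*-monoˡ {x} 0≤x = *-monoˡ-≤-nonNeg x {{nonNegative 0≤x}}

*-monoʳ : 0ℚ ≤ x → p ≤ q → p * x ≤ q * x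
*-monoʳ {x} 0≤x = *-monoʳ-≤-nonNeg x {{nonNegative 0≤x}}

0≤^ : ∀ n → 0ℚ ≤ q → 0ℚ ≤ q ^ n
0≤^ zero    0≤q = nonNegative⁻¹ 1ℚ
0≤^ (suc n) 0≤q = 0≤* 0≤q (0≤^ n 0≤q)

0<^ : ∀ n → 0ℚ < q → 0ℚ < q ^ n
0<^ zero    0<q = positive⁻¹ 1ℚ
0<^ (suc n) 0<q = 0<* 0<q (0<^ n 0<q)

^-mono : ∀ n → 0ℚ ≤ p → p ≤ q → p ^ n ≤ q ^ n
^-mono zero    0≤p p≤q = ≤-refl
^-mono (suc n) 0≤p p≤q =
  ≤-trans (*-monoˡ 0≤p (^-mono n 0≤p p≤q)) (*-monoʳ (0≤^ n (≤-trans 0≤p p≤q)) p≤q)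

^-mono-< : ∀ n .{{_ : NonZero n}} → 0ℚ ≤ p → p < q → p ^ n < q ^ n
^-mono-< {p} {q} (suc n) 0≤p p<q =
  ≤-<-trans (*-monoˡ 0≤p (^-mono n 0≤p (<⇒≤ p<q)))
            (*-monoˡ-<-pos (q ^ n) {{positive (0<^ n (≤-<-trans 0≤p p<q))}} p<q)

q≤q*qⁿ : ∀ n → 1ℚ ≤ q → 1ℚ ≤ q ^ n → q ≤ q * q ^ n
q≤q*qⁿ {q} n 1≤q 1≤qⁿ = subst (_≤ q * q ^ n) (*-identityʳ q)
  (*-monoˡ (≤-trans (nonNegative⁻¹ 1ℚ) 1≤q) 1≤qⁿ)

1≤^ : ∀ n → 1ℚ ≤ q → 1ℚ ≤ q ^ n
1≤^ zero    1≤q = ≤-refl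
1≤^ (suc n) 1≤q = ≤-trans 1≤q (q≤q*qⁿ n 1≤q (1≤^ n 1≤q))

≤^ : ∀ n .{{_ : NonZero n}} → 1ℚ ≤ q → q ≤ q ^ n
≤^ (suc n) 1≤q = q≤q*qⁿ n 1≤q (1≤^ n 1≤q)

q<q+1 : ∀ q → q < q + 1ℚ
q<q+1 q = subst (_< q + 1ℚ) (+-identityʳ q) (+-monoʳ-< q (positive⁻¹ 1ℚ))

module _ (x : ℚ) (0<x : 0ℚ < x) where
  private instance
    x-pos : Positive x
    x-pos = positive 0<x
    x-nonZero = pos⇒nonZero x

  x*b/x : ∀ b → x * (1/ x * b) ≡ b
  x*b/x b = trans (sym (*-assoc x (1/ x) b))
                  (trans (cong (_* b) (*-inverseʳ x)) (*-identityˡ b))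

  enlarge⁺ : x * y < b → ∃[ c ] y < c × x * c < b
  enlarge⁺ {y} {b} xy<b
    with c , y<c , c<b/x ← <-dense {y} {1/ x * b}
           (*-cancelˡ-<-nonNeg x {{pos⇒nonNeg x}} (subst (x * y <_) (sym (x*b/x b)) xy<b))
    = c , y<c , subst (x * c <_) (x*b/x b) (*-monoʳ-<-pos x c<b/x)

  shrink : a < x * y → ∃[ c ] c < y × a < x * c
  shrink {a} {y} a<xy
    with c , a/x<c , c<y ← <-dense {1/ x * a} {y}
           (*-cancelˡ-<-nonNeg x {{pos⇒nonNeg x}} (subst (_< x * y) (sym (x*b/x a)) a<xy))
    = c , c<y , subst (_< x * c) (x*b/x a) (*-monoʳ-<-pos x a/x<c)

enlarge : 0ℚ ≤ x → x * y < b → ∃[ c ] y < c × x * c < b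
enlarge {x} {y} {b} 0≤x xy<b with <-cmp 0ℚ x
... | tri< 0<x _ _ = enlarge⁺ x 0<x xy<b
... | tri> _ _ x<0 = contradiction 0≤x (<⇒≱ x<0)
  where
  <⇒≱ : ∀ {p q} → p < q → ¬ (q ≤ p)
  <⇒≱ p<q q≤p = <-irrefl refl (<-≤-trans p<q q≤p)
... | tri≈ _ refl _ = y + 1ℚ , q<q+1 y ,
  subst (_< b) (trans (*-zeroˡ y) (sym (*-zeroˡ (y + 1ℚ)))) xy<b

^-open-above : ∀ n → 0ℚ ≤ q → q ^ n < b → ∃[ r ] q < r × r ^ n < b
^-open-above {q} zero    0≤q 1<b = q + 1ℚ , q<q+1 q , 1<b
^-open-above {q} {b} (suc n) 0≤q qⁿ⁺¹<b
  with c , qⁿ<c , qc<b ← enlarge {q} {q ^ n} 0≤q qⁿ⁺¹<b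
  with 0≤c ← ≤-trans (0≤^ n 0≤q) (<⇒≤ qⁿ<c)
  with s , q<s , sⁿ<c ← ^-open-above n 0≤q qⁿ<c
  with t , q<t , ct<b ← enlarge {c} {q} 0≤c (subst (_< b) (*-comm q c) qc<b)
  with ≤-total s t
... | inj₁ s≤t = s , q<s , ≤-<-trans (*-monoˡ (≤-trans 0≤q (<⇒≤ q<s)) (<⇒≤ sⁿ<c))
                   (≤-<-trans (*-monoʳ 0≤c s≤t) (subst (_< b) (*-comm c t) ct<b))
... | inj₂ t≤s = t , q<t , ≤-<-trans (*-monoˡ 0≤t (≤-trans (^-mono n 0≤t t≤s) (<⇒≤ sⁿ<c)))
                   (subst (_< b) (*-comm c t) ct<b)
  where 0≤t = ≤-trans 0≤q (<⇒≤ q<t)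

^-open-below : ∀ n → 0ℚ ≤ a → 0ℚ < q → a < q ^ n → ∃[ r ] 0ℚ < r × r < q × a < r ^ n
^-open-below {a} {q} zero    0≤a 0<q a<1 with r , 0<r , r<q ← <-dense 0<q
  = r , 0<r , r<q , a<1
^-open-below {a} {q} (suc n) 0≤a 0<q a<qⁿ⁺¹
  with c , c<qⁿ , a<qc ← shrink q 0<q {a} {q ^ n} a<qⁿ⁺¹
  with 0<c ← *-cancelˡ-<-nonNeg q {{pos⇒nonNeg q {{positive 0<q}}}} {0ℚ} {c}
               (subst (_< q * c) (sym (*-zeroʳ q)) (≤-<-trans 0≤a a<qc))
  with s , 0<s , s<q , c<sⁿ ← ^-open-below n (<⇒≤ 0<c) 0<q c<qⁿ
  with t , t<q , a<ct ← shrink c 0<c {a} {q} (subst (a <_) (*-comm q c) a<qc)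
  with ≤-total s t
... | inj₁ s≤t = t , <-≤-trans 0<s s≤t , t<q ,
  <-≤-trans (subst (a <_) (*-comm c t) a<ct)
            (*-monoˡ (≤-trans (<⇒≤ 0<s) s≤t)
                     (≤-trans (<⇒≤ c<sⁿ) (^-mono n (<⇒≤ 0<s) s≤t)))
... | inj₂ t≤s = s , 0<s , s<q ,
  <-≤-trans (subst (a <_) (*-comm c t) a<ct)
            (≤-trans (*-monoʳ (<⇒≤ 0<c) t≤s) (*-monoˡ (<⇒≤ 0<s) (<⇒≤ c<sⁿ)))

------------------------------------------------------------------------
-- Roots

fromℕ : ℕ → ℚ
fromℕ a = ℤ.+ a / 1

0≤fromℕ : ∀ a → 0ℚ ≤ fromℕ a
0≤fromℕ a = nonNegative⁻¹ (fromℕ a) {{normalize-nonNeg a 1}}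

-- The nonnegative n-th root of a.
root : ∀ n .{{_ : NonZero n}} → ℕ → ℝ
root n a = record
  { Lower           = Lo
  ; Upper           = Up
  ; lower-inhabited = - 1ℚ , inj₁ (negative⁻¹ (- 1ℚ))
  ; upper-inhabited = A + 1ℚ , ≤-<-trans 0≤A (q<q+1 A) , <-≤-trans (q<q+1 A) (≤^ n 1≤A+1)
  ; lower-rounded   = λ p → mk⇔ lo-open (λ (q , p<q , lo) → lo-closed p<q lo)
  ; upper-rounded   = λ q → mk⇔ up-open (λ (p , p<q , up) → up-closed p<q up)
  ; disjoint        = disj
  ; located         = loc
  }
  where
  A = fromℕ a
  0≤A = 0≤fromℕ a

  1≤A+1 : 1ℚ ≤ A + 1ℚ
  1≤A+1 = subst (_≤ A + 1ℚ) (+-identityˡ 1ℚ) (+-monoˡ-≤ 1ℚ 0≤A)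

  Lo Up : ℚ → Set
  Lo q = q < 0ℚ ⊎ q ^ n < A
  Up q = 0ℚ < q × A < q ^ n

  lo-open : Lo p → ∃[ q ] p < q × Lo q
  lo-open {p} lo with p <? 0ℚ
  lo-open lo | yes p<0 with q , p<q , q<0 ← <-dense p<0 = q , p<q , inj₁ q<0
  lo-open (inj₁ p<0)  | no p≮0 = contradiction p<0 p≮0
  lo-open (inj₂ pⁿ<A) | no p≮0 with q , p<q , qⁿ<A ← ^-open-above n (≮⇒≥ p≮0) pⁿ<A
    = q , p<q , inj₂ qⁿ<A

  lo-closed : p < q → Lo q → Lo p
  lo-closed p<q (inj₁ q<0) = inj₁ (<-trans p<q q<0)
  lo-closed {p} p<q (inj₂ qⁿ<A) with p <? 0ℚ
  ... | yes p<0 = inj₁ p<0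
  ... | no  p≮0 = inj₂ (≤-<-trans (^-mono n (≮⇒≥ p≮0) (<⇒≤ p<q)) qⁿ<A)

  up-open : Up q → ∃[ p ] p < q × Up p
  up-open (0<q , A<qⁿ) with p , 0<p , p<q , A<pⁿ ← ^-open-below n 0≤A 0<q A<qⁿ
    = p , p<q , 0<p , A<pⁿ

  up-closed : p < q → Up p → Up q
  up-closed p<q (0<p , A<pⁿ) =
    <-trans 0<p p<q , <-≤-trans A<pⁿ (^-mono n (<⇒≤ 0<p) (<⇒≤ p<q))

  disj : ∀ q → ¬ (Lo q × Up q)
  disj q (inj₁ q<0  , 0<q , _)  = <-asym q<0 0<q
  disj q (inj₂ qⁿ<A , _ , A<qⁿ) = <-asym qⁿ<A A<qⁿ

  loc : ∀ p q → p < q → Lo p ⊎ Up q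
  loc p q p<q with p <? 0ℚ
  ... | yes p<0 = inj₁ (inj₁ p<0)
  ... | no  p≮0 with p ^ n <? A
  ...   | yes pⁿ<A = inj₁ (inj₂ pⁿ<A)
  ...   | no  pⁿ≮A = inj₂ (≤-<-trans (≮⇒≥ p≮0) p<q ,
                           ≤-<-trans (≮⇒≥ pⁿ≮A) (^-mono-< n (≮⇒≥ p≮0) p<q))

{-# OPTIONS --safe #-}

-- Every block of positions [l, l + m) with m ≤ l + 1 contains no vertex
-- together with one of its children, so the direct sum of an avoiding heap on l
-- vertices and any avoider in S_m is again an avoiding heap. Halving n repeatedly gives
-- h ⌊n/2⌋ * a ⌈n/2⌉ ≤ h n ≤ a n. Direct sums also make a supermultiplicative:
-- if y ^ m < a m, then y ^ n < a n for all large n, and the halving inequality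
-- transports this to h. Hence both root sequences converge to the supremum of
-- the roots of a, which is finite by the Marcus–Tardos theorem and Klazar's
-- reduction of the Stanley–Wilf conjecture to it.
module Submission where

open import Defs
open import Axiom.ExcludedMiddle using (ExcludedMiddle)
open import Data.Empty using (⊥; ⊥-elim)
open import Data.Fin using (Fin; zero; suc; toℕ)
import Data.Fin as Fin
open import Data.Fin.Permutation using (Permutation′; permutation; _⟨$⟩ʳ_; _⟨$⟩ˡ_; inverseˡ; inverseʳ; flip; _≈_)
  renaming (id to idₚ)
open import Data.Nat using (ℕ; zero; suc; _≤_; z≤n; s≤s; s≤s⁻¹; NonZero; ⌊_/2⌋; ⌈_/2⌉)
import Data.Nat as ℕ
import Data.Nat.Properties as ℕ
open import Data.Product using (Σ-syntax; ∃-syntax; ∃₂; _×_; _,_; proj₁; proj₂)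
open import Data.Sum using (_⊎_; inj₁; inj₂)
open import Function using (_∘_; mk⇔; _⇔_; Equivalence; Inverse; Injection)
open import Function.Construct.Identity using (⇔-id)
open import Function.Definitions using (Injective)
open import Function.Properties.Inverse using (↔⇒↣; Inverse⇒Injection) renaming (sym to inverse-sym)
open import Level using (0ℓ)
open import Relation.Binary.Bundles using (Setoid)
open import Relation.Binary.PropositionalEquality hiding (J; setoid)
open import Relation.Nullary using (¬_; yes; no; does; Dec)
open import Relation.Unary using (Decidable)

-- The delicate point is the passage from `a` to `h`. Supermultiplicativity alone gives x ^ n ≤ C *
-- a n with a constant C, and a constant in front of `a` would be paid again at every halving. The
-- constant therefore has to disappear before halving starts. Lowering the base from x to w absorbs
-- it and leaves w ^ n ≤ a n for all n ≥ J, so halving is lossless while the second half has length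
-- at least J. What remains has length at most 2 J and costs one factor w ^ (2 J), which lowering
-- the base once more, from w to y, absorbs.
--
-- Excluded middle enters at two places. Avoiding infinitely many patterns need not be decidable, so
-- it decides which codes are attained when a set is counted. It also decides whether a rational
-- lies below some root, which makes the supremum a located cut.

module PatternMatrices where

  open import Algebra.Properties.Semiring.Sum ℕ.+-*-semiring
    using (sum; ∑-distrib-+; ∑-comm; sum-cong-≗; *-distribˡ-sum; *-distribʳ-sum)
  open import Data.Bool using (Bool; true; false; _∧_; _∨_)
  open import Data.Bool.Properties using (∨-zeroʳ)
  open import Data.Fin using (combine; funToFin; finToFun; quotient; remainder; inject≤; _↑ˡ_; _↑ʳ_)
  open import Data.Fin.Properties using
    (combine-monoˡ-<; toℕ-combine; combine-injective; combine-surjective; remQuot-combine;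
     finToFun-funToFin; inject≤-injective; toℕ-inject≤; toℕ-injective; any?)
  open import Data.Nat using (_+_; _*_; _<_; _<?_; _≤?_)
  open import Data.Nat.Properties
  import Data.Nat.Solver
  open import Relation.Binary.Definitions using (tri<; tri≈; tri>)
  open import Relation.Nullary.Decidable using (dec-true; _×-dec_)

  -- Finite sums, counting and selection

  Increasing : ∀ {k n} → (Fin k → Fin n) → Set
  Increasing f = ∀ {i j} → i Fin.< j → f i Fin.< f j

  sum-mono : ∀ {n} {f g : Fin n → ℕ} → (∀ i → f i ≤ g i) → sum f ≤ sum g
  sum-mono {zero}  f≤g = z≤n
  sum-mono {suc n} f≤g = +-mono-≤ (f≤g zero) (sum-mono (f≤g ∘ suc))

  sum-const : ∀ n c → sum {n} (λ _ → c) ≡ n * c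
  sum-const zero    c = refl
  sum-const (suc n) c = cong (c +_) (sum-const n c)

  sum-≤-const : ∀ {n} {f : Fin n → ℕ} c → (∀ i → f i ≤ c) → sum f ≤ n * c
  sum-≤-const {n} c f≤c = ≤-trans (sum-mono f≤c) (≤-reflexive (sum-const n c))

  term≤sum : ∀ {n} (f : Fin n → ℕ) i → f i ≤ sum f
  term≤sum f zero    = m≤m+n (f zero) _
  term≤sum f (suc i) = ≤-trans (term≤sum (f ∘ suc) i) (m≤n+m _ (f zero))

  sum-↑ : ∀ m {n} (f : Fin (m + n) → ℕ) → sum f ≡ sum (λ i → f (i ↑ˡ n)) + sum (λ j → f (m ↑ʳ j))
  sum-↑ zero    f = refl
  sum-↑ (suc m) f = trans (cong (f zero +_) (sum-↑ m (f ∘ suc))) (sym (+-assoc (f zero) _ _))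

  sum-combine : ∀ m n (f : Fin (m * n) → ℕ) → sum f ≡ sum (λ i → sum (λ j → f (combine {m} {n} i j)))
  sum-combine zero    n f = refl
  sum-combine (suc m) n f = trans (sum-↑ n f) (cong (sum (λ i → f (i ↑ˡ m * n)) +_) (sum-combine m n _))

  𝟙 : Bool → ℕ
  𝟙 true  = 1
  𝟙 false = 0

  count : ∀ {n} → (Fin n → Bool) → ℕ
  count p = sum (𝟙 ∘ p)

  count≤ : ∀ {n} (p : Fin n → Bool) → count p ≤ n
  count≤ {n} p = ≤-trans (sum-≤-const 1 (λ i → 𝟙≤1 (p i))) (≤-reflexive (*-identityʳ n))
    where
    𝟙≤1 : ∀ b → 𝟙 b ≤ 1
    𝟙≤1 true  = ≤-refl
    𝟙≤1 false = z≤n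

  select : ∀ {n} (p : Fin n → Bool) k → k ≤ count p →
           ∃[ r ] Increasing {k} {n} r × (∀ j → p (r j) ≡ true)
  select {zero}  p zero    _ = (λ ()) , (λ { {()} }) , λ ()
  select {suc n} p k       k≤ with p zero in p0
  select {suc n} p zero    k≤ | true = (λ ()) , (λ { {()} }) , λ ()
  select {suc n} p (suc k) k≤ | true with r , r-inc , pr ← select (p ∘ suc) k (s≤s⁻¹ k≤) = r′ , inc , pr′
    where
    r′ : Fin (suc k) → Fin (suc n)
    r′ zero    = zero
    r′ (suc j) = suc (r j)
    inc : Increasing r′
    inc {zero}  {suc j} _         = s≤s z≤n
    inc {suc i} {suc j} (s≤s i<j) = s≤s (r-inc i<j)
    pr′ : ∀ j → p (r′ j) ≡ true
    pr′ zero    = p0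
    pr′ (suc j) = pr j
  select {suc n} p k       k≤ | false with r , r-inc , pr ← select (p ∘ suc) k k≤
    = suc ∘ r , (λ i<j → s≤s (r-inc i<j)) , pr

  some : ∀ {n} → (Fin n → Bool) → Bool
  some {zero}  p = false
  some {suc n} p = p zero ∨ some (p ∘ suc)

  some-intro : ∀ {n} (p : Fin n → Bool) i → p i ≡ true → some p ≡ true
  some-intro p zero    pi rewrite pi = refl
  some-intro p (suc i) pi rewrite some-intro (p ∘ suc) i pi = ∨-zeroʳ (p zero)

  some-elim : ∀ {n} (p : Fin n → Bool) → some p ≡ true → ∃[ i ] p i ≡ true
  some-elim {suc n} p h with p zero in p0
  ... | true  = zero , p0
  ... | false with i , pi ← some-elim (p ∘ suc) h = suc i , pi

  some-false : ∀ {n} (p : Fin n → Bool) → some p ≡ false → ∀ i → p i ≡ false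
  some-false p h i with p i in pi
  ... | false = refl
  ... | true with () ← trans (sym h) (some-intro p i pi)

  does-elim : ∀ {P : Set} (d : Dec P) → does d ≡ true → P
  does-elim (yes p) _ = p

  ∧-elim : ∀ {x y} → x ∧ y ≡ true → x ≡ true × y ≡ true
  ∧-elim {true} {true} _ = refl , refl

  bit : Bool → Fin 2
  bit true  = suc zero
  bit false = zero

  bit-injective : ∀ {x y} → bit x ≡ bit y → x ≡ y
  bit-injective {true}  {true}  _ = refl
  bit-injective {false} {false} _ = refl

  funToFin-injective : ∀ {m n} {f g : Fin m → Fin n} → funToFin f ≡ funToFin g → f ≗ g
  funToFin-injective {f = f} {g} eq i =
    trans (sym (finToFun-funToFin f i)) (trans (cong (λ x → finToFun x i) eq) (finToFun-funToFin g i))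

  -- Pattern containment in 0-1 matrices, and contraction of blocks

  Matrix : ℕ → Set
  Matrix n = Fin n → Fin n → Bool

  transpose : ∀ {n} → Matrix n → Matrix n
  transpose M i j = M j i

  -- Ones are demanded only where the permutation matrix of `π` has them; its zeros impose nothing.
  -- Hence a contraction, which may have more ones than any choice of entries in the blocks, can
  -- still be compared with `M`.
  record Contains {k n} (π : Permutation′ k) (M : Matrix n) : Set where
    field
      row            : Fin k → Fin n
      row-increasing : Increasing row
      col            : Fin k → Fin n
      col-increasing : Increasing col
      entry          : ∀ j → M (row j) (col (π ⟨$⟩ʳ j)) ≡ true

  -- Exchanging rows and columns inverts the pattern. Through this the bound on blocks with many
  -- nonzero columns also applies to blocks with many nonzero rows.
  contains-transpose : ∀ {k n} {π : Permutation′ k} {M : Matrix n} →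
                       Contains (flip π) (transpose M) → Contains π M
  contains-transpose {π = π} {M} c = record
    { row = col; row-increasing = col-increasing
    ; col = row; col-increasing = row-increasing
    ; entry = λ l → subst (λ z → M (col z) (row (π ⟨$⟩ʳ l)) ≡ true) (inverseˡ π) (entry (π ⟨$⟩ʳ l)) }
    where open Contains c

  combine-monoʳ-< : ∀ {m n} (i : Fin m) {j l : Fin n} → j Fin.< l → combine i j Fin.< combine i l
  combine-monoʳ-< {n = n} i {j} {l} j<l =
    subst₂ _<_ (sym (toℕ-combine i j)) (sym (toℕ-combine i l)) (+-monoʳ-< (n * toℕ i) j<l)

  module _ (N b : ℕ) where

    block : Matrix (N * b) → Fin N → Fin N → Matrix b
    block M I J i j = M (combine I i) (combine J j)

    hitColumns : Matrix (N * b) → Fin N → Fin N → Fin b → Bool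
    hitColumns M I J c = some (λ i → block M I J i c)

    contract : Matrix (N * b) → Matrix N
    contract M I J = some (hitColumns M I J)

    contract-elim : ∀ M {I J} → contract M I J ≡ true → ∃[ i ] ∃[ j ] block M I J i j ≡ true
    contract-elim M h with j , hj ← some-elim _ h with i , hi ← some-elim _ hj = i , j , hi

    contract-false : ∀ M {I J} → contract M I J ≡ false → ∀ i j → block M I J i j ≡ false
    contract-false M h i j = some-false _ (some-false _ h j) i

    -- The entries of an occurrence lie in pairwise different block rows and block columns, so an
    -- arbitrary one in each block keeps their relative order.
    contains-contract : ∀ {k} {π : Permutation′ k} M → Contains π (contract M) → Contains π M
    contains-contract {π = π} M c = record
      { row = λ j → combine (row j) (proj₁ (wit j))
      ; row-increasing = λ i<j → combine-monoˡ-< _ _ (row-increasing i<j)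
      -- Witnesses are indexed by rows; column `l` belongs to the row that `π` sends to `l`.
      ; col = λ l → combine (col l) (proj₁ (proj₂ (wit (π ⟨$⟩ˡ l))))
      ; col-increasing = λ i<j → combine-monoˡ-< _ _ (col-increasing i<j)
      ; entry = λ j → subst (λ z → M (combine (row j) (proj₁ (wit j)))
                                     (combine (col (π ⟨$⟩ʳ j)) (proj₁ (proj₂ (wit z)))) ≡ true)
                            (sym (inverseˡ π)) (proj₂ (proj₂ (wit j)))
      }
      where
      open Contains c
      wit : ∀ j → ∃[ i ] ∃[ c ] block M (row j) (col (π ⟨$⟩ʳ j)) i c ≡ true
      wit j = contract-elim M (entry j)

    -- The threshold is meant for patterns of size k + 1: a wide block has enough nonzero columns to
    -- supply all columns of the pattern.
    wide : ℕ → Matrix (N * b) → Fin N → Fin N → Bool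
    wide k M I J = does (k <? count (hitColumns M I J))

    -- Among the blocks of one block column that hit the same set of more than
    -- k columns, k + 1 would contain π.
    wide-bound : ∀ {k} (π : Permutation′ (suc k)) M → ¬ Contains π M →
                 ∀ J → count (λ I → wide k M I J) ≤ 2 ℕ.^ b * k
    wide-bound {k} π M avoids J = begin
      count (λ I → wide k M I J)                   ≤⟨ sum-mono (λ I → refine I) ⟩
      sum (λ I → count (λ s → hits s I))           ≡⟨ ∑-comm (λ I s → 𝟙 (hits s I)) ⟩
      sum (λ s → count (hits s))                   ≤⟨ sum-≤-const k few ⟩
      2 ℕ.^ b * k                                    ∎
      where
      open ≤-Reasoning
      code : Fin N → Fin (2 ℕ.^ b)
      code I = funToFin (bit ∘ hitColumns M I J)
      hits : Fin (2 ℕ.^ b) → Fin N → Bool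
      hits s I = does (code I Fin.≟ s) ∧ wide k M I J
      refine : ∀ I → 𝟙 (wide k M I J) ≤ count (λ s → hits s I)
      refine I = ≤-trans (≤-reflexive (cong (λ z → 𝟙 (z ∧ wide k M I J)) (sym (dec-true (code I Fin.≟ code I) refl))))
                         (term≤sum (λ s → 𝟙 (hits s I)) (code I))
      hits-elim : ∀ s I → hits s I ≡ true → code I ≡ s × k < count (hitColumns M I J)
      hits-elim s I h with c≡s , w ← ∧-elim h = does-elim (code I Fin.≟ s) c≡s , does-elim (k <? _) w
      few : ∀ s → count (hits s) ≤ k
      few s with k <? count (hits s)
      ... | no  k≮ = ≮⇒≥ k≮
      -- The k + 1 columns `C` are nonzero in the first of the chosen blocks, hence in all of them.
      -- Every pair of a chosen block and a chosen column then offers a one, so any permutation of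
      -- size k + 1 can be realised.
      ... | yes k< with R , R-inc , hR ← select (hits s) (suc k) k<
        with C , C-inc , hC ← select (hitColumns M (R zero) J) (suc k) (proj₂ (hits-elim s _ (hR zero)))
        = ⊥-elim (avoids (record
          { row = λ j → combine (R j) (proj₁ (wit j (π ⟨$⟩ʳ j)))
          ; row-increasing = λ i<j → combine-monoˡ-< _ _ (R-inc i<j)
          ; col = λ l → combine J (C l)
          ; col-increasing = λ i<j → combine-monoʳ-< J (C-inc i<j)
          ; entry = λ j → proj₂ (wit j (π ⟨$⟩ʳ j)) }))
        where
        wit : ∀ j l → ∃[ i ] block M (R j) J i (C l) ≡ true
        wit j l = some-elim _ (trans (bit-injective (funToFin-injective same (C l))) (hC l))
          where
          same : code (R j) ≡ code (R zero)
          same = trans (proj₁ (hits-elim s _ (hR j))) (sym (proj₁ (hits-elim s _ (hR zero))))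

  weight : ∀ {n} → Matrix n → ℕ
  weight M = sum (λ i → count (M i))

  weight≤ : ∀ {n} (M : Matrix n) → weight M ≤ n * n
  weight≤ {n} M = sum-≤-const n (λ i → count≤ (M i))

  -- All ones lie in the product of the set of nonzero rows and the set of nonzero columns.
  weight-≤-hits : ∀ {n} (M : Matrix n) →
                  weight M ≤ count (λ i → some (M i)) * count (λ j → some (λ i → M i j))
  weight-≤-hits M = begin
    weight M                                      ≤⟨ sum-mono (λ i → sum-mono (λ j → pointwise i j)) ⟩
    sum (λ i → sum (λ j → 𝟙 (R i) * 𝟙 (C j)))     ≡⟨ sum-cong-≗ (λ i → sym (*-distribˡ-sum (𝟙 (R i)) (𝟙 ∘ C))) ⟩
    sum (λ i → 𝟙 (R i) * count C)                 ≡⟨ sym (*-distribʳ-sum (count C) (𝟙 ∘ R)) ⟩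
    count R * count C                             ∎
    where
    open ≤-Reasoning
    R C : Fin _ → Bool
    R i = some (M i)
    C j = some (λ i → M i j)
    pointwise : ∀ i j → 𝟙 (M i j) ≤ 𝟙 (R i) * 𝟙 (C j)
    pointwise i j with M i j in e
    ... | false = z≤n
    ... | true rewrite some-intro (M i) j e | some-intro (λ i → M i j) i e = ≤-refl

  weight-blocks : ∀ N b (M : Matrix (N * b)) →
                  weight M ≡ sum (λ I → sum (λ J → weight (block N b M I J)))
  weight-blocks N b M = begin
    weight M                                              ≡⟨ sum-combine N b (count ∘ M) ⟩
    sum (λ I → sum (λ i → count (M (combine {N} {b} I i))))
      ≡⟨ sum-cong-≗ {N} (λ I → sum-cong-≗ {b} (λ i → sum-combine N b (λ y → 𝟙 (M (combine {N} {b} I i) y)))) ⟩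
    sum (λ I → sum (λ i → sum (λ J → count (block N b M I J i))))
      ≡⟨ sum-cong-≗ {N} (λ I → ∑-comm {b} {N} (λ i J → count (block N b M I J i))) ⟩
    sum (λ I → sum (λ J → weight (block N b M I J))) ∎
    where open ≡-Reasoning

  -- The values of g on the support of p, in order, padded or truncated to length w.
  pack : ∀ {n} {A : Set} (w : ℕ) → A → (Fin n → Bool) → (Fin n → A) → Fin w → A
  pack {zero}  w       z p g i       = z
  pack {suc n} zero    z p g ()
  pack {suc n} (suc w) z p g i       with p zero
  pack {suc n} (suc w) z p g zero    | true  = g zero
  pack {suc n} (suc w) z p g (suc i) | true  = pack w z (p ∘ suc) (g ∘ suc) i
  pack {suc n} (suc w) z p g i       | false = pack (suc w) z (p ∘ suc) (g ∘ suc) i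

  -- Equal supports keep the two lists in step, and `count p ≤ w` ensures that no value on the
  -- support is cut off.
  pack-injective : ∀ {n} {A : Set} w {z : A} {p q : Fin n → Bool} {g h : Fin n → A} →
                   count p ≤ w → p ≗ q → pack w z p g ≗ pack w z q h →
                   ∀ i → p i ≡ true → g i ≡ h i
  pack-injective {suc n} w {p = p} {q} c p≗q eq i pi with p zero in p0 | q zero in q0 | p≗q zero
  pack-injective {suc n} zero    () p≗q eq i pi | true | true | _
  pack-injective {suc n} (suc w) {p = p} {q} c p≗q eq zero    pi | true | true | _
    with e ← eq zero rewrite p0 | q0 = e
  pack-injective {suc n} (suc w) {z} {p} {q} {g} {h} c p≗q eq (suc i) pi | true | true | _ =
    pack-injective w (s≤s⁻¹ c) (p≗q ∘ suc) tails i pi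
    where
    tails : pack w z (p ∘ suc) (g ∘ suc) ≗ pack w z (q ∘ suc) (h ∘ suc)
    tails j with e ← eq (suc j) rewrite p0 | q0 = e
  pack-injective {suc n} w c p≗q eq zero pi | false | false | _ with () ← trans (sym p0) pi
  pack-injective {suc n} zero    {z} {p} {q} {g} {h} c p≗q eq (suc i) pi | false | false | _ =
    pack-injective zero {z} {p ∘ suc} {q ∘ suc} {g ∘ suc} {h ∘ suc} c (p≗q ∘ suc) (λ ()) i pi
  pack-injective {suc n} (suc w) {z} {p} {q} {g} {h} c p≗q eq (suc i) pi | false | false | _ =
    pack-injective (suc w) c (p≗q ∘ suc) tails i pi
    where
    tails : pack (suc w) z (p ∘ suc) (g ∘ suc) ≗ pack (suc w) z (q ∘ suc) (h ∘ suc)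
    tails j with e ← eq j rewrite p0 | q0 = e

  flatten : ∀ {A : Set} n → (Fin n → Fin n → A) → Fin (n * n) → A
  flatten n M x = M (quotient {n} n x) (remainder {n} n x)

  flatten-combine : ∀ {A : Set} n (M : Fin n → Fin n → A) i j → flatten n M (combine i j) ≡ M i j
  flatten-combine n M i j = cong (λ (x , y) → M x y) (remQuot-combine {n} {n} i j)

  count-flatten : ∀ n (M : Matrix n) → count (flatten n M) ≡ weight M
  count-flatten n M = trans (sum-combine n n (𝟙 ∘ flatten n M))
    (sum-cong-≗ {n} λ i → sum-cong-≗ {n} λ j → cong 𝟙 (flatten-combine n M i j))

  flatten-cong : ∀ {A : Set} n {M M′ : Fin n → Fin n → A} →
                 (∀ i j → M i j ≡ M′ i j) → flatten n M ≗ flatten n M′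
  flatten-cong n eq x = eq (quotient {n} n x) (remainder {n} n x)

  -- The Marcus-Tardos theorem: avoiders have linearly many ones

  -- With b one more than 1 + k², the recursion w (N b) ≤ (1 + k²) w N + E N for
  -- the maximal weight of an avoider has the linear solution w n ≤ (1 + E) n.
  -- b and E are parameters so that they do not unfold.
  module StanleyWilf (k b E : ℕ) (b≡ : b ≡ 2 + k * k) (E≡ : E ≡ 2 * (b * b * (2 ℕ.^ b * k))) where

    -- `E` is the price of exceptional blocks per line of blocks: at most 2 ^ b * k wide ones in a
    -- block column and as many tall ones in a block row, each with at most b * b ones. The
    -- successor makes `D` positive, as the 1 × 1 case requires.
    D : ℕ
    D = suc E

    side : ℕ → ℕ
    side zero    = 1
    side (suc t) = side t * b

    -- More than `k` nonzero rows, expressed as wideness in the transpose, where the block has its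
    -- two indices exchanged.
    tall : ∀ N → Matrix (N * b) → Matrix N
    tall N M I J = wide N b k (transpose M) J I

    -- A wide or tall block has at most b * b ones, an empty one has none, and any other has at most
    -- `k` nonzero rows and `k` nonzero columns, hence at most k * k ones. Rounding k * k up to its
    -- successor makes b at least 2 even for k = 0, so that `side` grows.
    block-bound : ∀ N (M : Matrix (N * b)) I J →
      weight (block N b M I J) ≤
        suc (k * k) * 𝟙 (contract N b M I J)
          + (b * b * 𝟙 (wide N b k M I J) + b * b * 𝟙 (tall N M I J))
    block-bound N M I J = cases (contract N b M I J) refl (k <? _) (k <? _)
      where
      open ≤-Reasoning
      B = block N b M I J
      cases : ∀ x → contract N b M I J ≡ x →
              (w : Dec (k < count (hitColumns N b M I J)))
              (t : Dec (k < count (hitColumns N b (transpose M) J I))) →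
              weight B ≤ suc (k * k) * 𝟙 x + (b * b * 𝟙 (does w) + b * b * 𝟙 (does t))
      cases x _ (yes _) t = begin
        weight B                                  ≤⟨ weight≤ B ⟩
        b * b                                     ≡⟨ *-identityʳ _ ⟨
        b * b * 1                                 ≤⟨ m≤m+n _ _ ⟩
        b * b * 1 + b * b * 𝟙 (does t)            ≤⟨ m≤n+m _ (suc (k * k) * 𝟙 x) ⟩
        suc (k * k) * 𝟙 x + (b * b * 1 + b * b * 𝟙 (does t)) ∎
      cases x _ (no _) (yes _) = begin
        weight B                                  ≤⟨ weight≤ B ⟩
        b * b                                     ≡⟨ *-identityʳ _ ⟨
        b * b * 1                                 ≤⟨ m≤n+m _ (b * b * 0) ⟩
        b * b * 0 + b * b * 1                     ≤⟨ m≤n+m _ (suc (k * k) * 𝟙 x) ⟩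
        suc (k * k) * 𝟙 x + (b * b * 0 + b * b * 1) ∎
      cases false e (no _) (no _) = ≤-trans (≤-reflexive empty) z≤n
        where
        sum-zero : ∀ {f : Fin b → ℕ} → (∀ i → f i ≡ 0) → sum f ≡ 0
        sum-zero f0 = trans (sum-cong-≗ f0) (trans (sum-const b 0) (*-zeroʳ b))
        empty : weight (block N b M I J) ≡ 0
        empty = sum-zero (λ i → sum-zero (λ j → cong 𝟙 (contract-false N b M e i j)))
      cases true _ (no k≮) (no k≮′) = begin
        weight B             ≤⟨ weight-≤-hits B ⟩
        count (λ i → some (B i)) * count (λ j → some (λ i → B i j))
                             ≤⟨ *-mono-≤ (≮⇒≥ k≮′) (≮⇒≥ k≮) ⟩
        k * k                ≤⟨ n≤1+n _ ⟩
        suc (k * k)          ≡⟨ *-identityʳ _ ⟨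
        suc (k * k) * 1      ≤⟨ m≤m+n _ _ ⟩
        suc (k * k) * 1 + (b * b * 0 + b * b * 0) ∎

    -- `block-bound` is summed over all blocks. Wide blocks are counted along block columns, tall
    -- ones along block rows by means of the inverse pattern.
    weight-step : ∀ N (π : Permutation′ (suc k)) (M : Matrix (N * b)) → ¬ Contains π M →
      weight M ≤ suc (k * k) * weight (contract N b M) + N * E
    weight-step N π M avoids = begin
      weight M ≡⟨ weight-blocks N b M ⟩
      ∑∑ (λ I J → weight (block N b M I J)) ≤⟨ sum-mono (λ I → sum-mono (block-bound N M I)) ⟩
      ∑∑ (λ I J → c * 𝟙 (contract N b M I J) + (d * 𝟙 (wide N b k M I J) + d * 𝟙 (tall N M I J)))
        ≡⟨ ∑∑-+ (λ I J → c * 𝟙 (contract N b M I J)) _ ⟩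
      ∑∑ (λ I J → c * 𝟙 (contract N b M I J)) + ∑∑ (λ I J → d * 𝟙 (wide N b k M I J) + d * 𝟙 (tall N M I J))
        ≡⟨ cong₂ _+_ (∑∑-* c _) (trans (∑∑-+ (λ I J → d * 𝟙 (wide N b k M I J)) _) (cong₂ _+_ (∑∑-* d _) (∑∑-* d _))) ⟩
      c * weight (contract N b M) + (d * weight (wide N b k M) + d * weight (tall N M))
        ≤⟨ +-monoʳ-≤ (c * weight (contract N b M)) (+-mono-≤ (*-monoʳ-≤ d wides) (*-monoʳ-≤ d talls)) ⟩
      c * weight (contract N b M) + (d * (N * e) + d * (N * e))
        ≡⟨ cong (c * weight (contract N b M) +_) (trans (arith d N e) (cong (N *_) (sym E≡))) ⟩
      c * weight (contract N b M) + N * E ∎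
      where
      open ≤-Reasoning
      c d e : ℕ
      c = suc (k * k)
      d = b * b
      e = 2 ℕ.^ b * k
      ∑∑ : (Fin N → Fin N → ℕ) → ℕ
      ∑∑ f = sum (λ I → sum (f I))
      ∑∑-+ : ∀ f g → ∑∑ (λ I J → f I J + g I J) ≡ ∑∑ f + ∑∑ g
      ∑∑-+ f g = trans (sum-cong-≗ (λ I → ∑-distrib-+ (f I) (g I))) (∑-distrib-+ (λ I → sum (f I)) (λ I → sum (g I)))
      ∑∑-* : ∀ x f → ∑∑ (λ I J → x * f I J) ≡ x * ∑∑ f
      ∑∑-* x f = sym (trans (*-distribˡ-sum x (λ I → sum (f I))) (sum-cong-≗ (λ I → *-distribˡ-sum x (f I))))
      wides : weight (wide N b k M) ≤ N * e
      wides = ≤-trans (≤-reflexive (∑-comm (λ I J → 𝟙 (wide N b k M I J)))) (sum-≤-const e (wide-bound N b π M avoids))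
      talls : weight (tall N M) ≤ N * e
      talls = sum-≤-const e (wide-bound N b (flip π) (transpose M) (avoids ∘ contains-transpose {π = π} {M}))
      arith : ∀ d N e → d * (N * e) + d * (N * e) ≡ N * (2 * (d * e))
      arith = let open Data.Nat.Solver.+-*-Solver in
        solve 3 (λ d N e → d :* (N :* e) :+ d :* (N :* e) := N :* (con 2 :* (d :* e))) refl

    weight-linear : ∀ (π : Permutation′ (suc k)) t (M : Matrix (side t)) → ¬ Contains π M → weight M ≤ D * side t
    weight-linear π zero    M avoids = ≤-trans (weight≤ M) (s≤s z≤n)
    weight-linear π (suc t) M avoids = begin
      weight M ≤⟨ weight-step N π M avoids ⟩
      c * weight (contract N b M) + N * E
        ≤⟨ +-mono-≤ (*-monoʳ-≤ c (weight-linear π t (contract N b M) (avoids ∘ contains-contract N b M)))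
                    (*-monoʳ-≤ N (n≤1+n E)) ⟩
      c * (D * N) + N * D ≡⟨ arith c D N ⟩
      D * (N * suc c)     ≡⟨ cong (λ z → D * (N * z)) (sym b≡) ⟩
      D * (N * b) ∎
      where
      open ≤-Reasoning
      N c : ℕ
      N = side t
      c = suc (k * k)
      arith : ∀ c D N → c * (D * N) + N * D ≡ D * (N * suc c)
      arith = let open Data.Nat.Solver.+-*-Solver in
        solve 3 (λ c D N → c :* (D :* N) :+ N :* D := D :* (N :* (con 1 :+ c))) refl

    -- Klazar's reduction: an exponential bound on the number of avoiders

    B : ℕ
    B = 2 ℕ.^ (b * b)

    -- `B` counts the b × b blocks. Each refinement multiplies the number of codes by one choice in
    -- `Fin B` for each of the at most D * side t nonzero entries of the contraction.
    K : ℕ → ℕ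
    K zero    = 2
    K (suc t) = K t * B ℕ.^ (D * side t)

    blockCode : ∀ N → Matrix (N * b) → Fin N → Fin N → Fin B
    blockCode N M I J = funToFin (bit ∘ flatten b (block N b M I J))

    packed : ∀ t → Matrix (side (suc t)) → Fin (D * side t) → Fin B
    -- The padding value is the code of the empty block; decoding looks at the support only and
    -- never reads it.
    packed t M = pack (D * side t) (funToFin {b * b} (λ _ → zero))
                      (flatten N (contract N b M)) (flatten N (blockCode N M))
      where N = side t

    -- Klazar's reduction: an avoider is determined by its contraction together
    -- with the blocks at the linearly many nonzero entries of the contraction.
    encode : ∀ t → Matrix (side t) → Fin (K t)
    encode zero    M = bit (M zero zero)
    encode (suc t) M = combine (encode t (contract (side t) b M)) (funToFin (packed t M))

    encode-injective : ∀ (π : Permutation′ (suc k)) t M M′ → ¬ Contains π M → ¬ Contains π M′ →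
                       encode t M ≡ encode t M′ → ∀ i j → M i j ≡ M′ i j
    encode-injective π zero    M M′ av av′ eq zero zero = bit-injective eq
    encode-injective π (suc t) M M′ av av′ eq x y
      with I , i , refl ← combine-surjective {side t} {b} x
      with J , j , refl ← combine-surjective {side t} {b} y
      with eq₁ , eq₂ ← combine-injective (encode t (contract (side t) b M)) (funToFin (packed t M)) _ _ eq
      = entry (contract N b M I J) refl
      where
      N = side t
      contracted : ∀ i j → contract N b M i j ≡ contract N b M′ i j
      contracted = encode-injective π t _ _ (av ∘ contains-contract N b M) (av′ ∘ contains-contract N b M′) eq₁
      -- The linear bound makes the list long enough: no block code is truncated.
      sparse : count (flatten N (contract N b M)) ≤ D * N
      sparse = ≤-trans (≤-reflexive (count-flatten N (contract N b M)))
                       (weight-linear π t _ (av ∘ contains-contract N b M))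
      codes : contract N b M I J ≡ true → blockCode N M I J ≡ blockCode N M′ I J
      codes h = trans (sym (flatten-combine N (blockCode N M) I J))
        (trans (pack-injective (D * N) {funToFin {b * b} (λ _ → zero)} sparse
                  (flatten-cong N contracted) (funToFin-injective {D * N} eq₂)
                  (combine I J) (trans (flatten-combine N (contract N b M) I J) h))
               (flatten-combine N (blockCode N M′) I J))
      entry : ∀ c → contract N b M I J ≡ c → block N b M I J i j ≡ block N b M′ I J i j
      entry true  h = trans (sym (flatten-combine b (block N b M I J) i j))
        (trans (bit-injective (funToFin-injective {b * b} (codes h) (combine i j)))
               (flatten-combine b (block N b M′ I J) i j))
      entry false h = trans (contract-false N b M h i j)
        (sym (contract-false N b M′ (trans (sym (contracted I J)) h) i j))

    instance
      B≢0 : NonZero B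
      B≢0 = m^n≢0 2 (b * b)

    2≤b : 2 ≤ b
    2≤b = ≤-trans (m≤m+n 2 (k * k)) (≤-reflexive (sym b≡))

    -- The exponents form a geometric progression of ratio b ≥ 2, so everything accumulated up to
    -- one level, doubled, is at most the next term.
    K≤ : ∀ t → K t ≤ B ℕ.^ (D * side t)
    K≤ zero    = begin
      2           ≤⟨ ^-monoʳ-≤ 2 (*-mono-≤ (≤-trans (n≤1+n 1) 2≤b) (≤-trans (n≤1+n 1) 2≤b)) ⟩
      B           ≡⟨ ^-identityʳ B ⟨
      B ℕ.^ 1       ≤⟨ ^-monoʳ-≤ B {1} {D * 1} (s≤s z≤n) ⟩
      B ℕ.^ (D * 1) ∎
      where open ≤-Reasoning
    K≤ (suc t) = begin
      K t * B ℕ.^ (D * s)           ≤⟨ *-monoˡ-≤ (B ℕ.^ (D * s)) (K≤ t) ⟩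
      B ℕ.^ (D * s) * B ℕ.^ (D * s)   ≡⟨ ^-distribˡ-+-* B (D * s) (D * s) ⟨
      B ℕ.^ (D * s + D * s)         ≤⟨ ^-monoʳ-≤ B le ⟩
      B ℕ.^ (D * (s * b))           ∎
      where
      open ≤-Reasoning
      s : ℕ
      s = side t
      le : D * s + D * s ≤ D * (s * b)
      le = begin
        D * s + D * s ≡⟨ *-distribˡ-+ D s s ⟨
        D * (s + s)   ≡⟨ cong (λ z → D * (s + z)) (+-identityʳ s) ⟨
        D * (2 * s)   ≡⟨ cong (D *_) (*-comm 2 s) ⟩
        D * (s * 2)   ≤⟨ *-monoʳ-≤ D (*-monoʳ-≤ s 2≤b) ⟩
        D * (s * b)   ∎

    -- Only sides that are powers of b are treated above. A permutation of any size is padded to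
    -- such a side at the cost of a factor b at most.
    side-between : ∀ n → ∃[ t ] suc n ≤ side t × side t ≤ b * suc n
    side-between zero = 0 , ≤-refl , ≤-trans (≤-trans (n≤1+n 1) 2≤b) (≤-reflexive (sym (*-identityʳ b)))
    side-between (suc n) with t , lo , hi ← side-between n with suc (suc n) ≤? side t
    ... | yes lo′ = t , lo′ , ≤-trans hi (*-monoʳ-≤ b (n≤1+n (suc n)))
    ... | no ¬lo′ = suc t , lo″ , hi″
      where
      open ≤-Reasoning
      lo″ : suc (suc n) ≤ side t * b
      lo″ = begin
        suc (suc n)     ≤⟨ s≤s (m≤n+m (suc n) n) ⟩
        suc n + suc n   ≡⟨ cong (suc n +_) (+-identityʳ (suc n)) ⟨
        2 * suc n       ≡⟨ *-comm 2 (suc n) ⟩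
        suc n * 2       ≤⟨ *-mono-≤ lo 2≤b ⟩
        side t * b      ∎
      hi″ : side t * b ≤ b * suc (suc n)
      hi″ = begin
        side t * b          ≤⟨ *-monoˡ-≤ b (s≤s⁻¹ (m≤n⇒m≤1+n (≰⇒> ¬lo′))) ⟩
        suc (suc n) * b     ≡⟨ *-comm (suc (suc n)) b ⟩
        b * suc (suc n)     ∎

  -- Permutations as matrices padded with zeros

  permMatrix : ∀ {n N} → n ≤ N → Permutation′ n → Matrix N
  permMatrix {n} n≤N σ i j = does (entry? i j)
    where
    entry? : ∀ i j → Dec (∃[ x ] inject≤ x n≤N ≡ i × inject≤ (σ ⟨$⟩ʳ x) n≤N ≡ j)
    entry? i j = any? (λ x → (inject≤ x n≤N Fin.≟ i) ×-dec (inject≤ (σ ⟨$⟩ʳ x) n≤N Fin.≟ j))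

  module _ {n N} (n≤N : n ≤ N) (σ : Permutation′ n) where

    permMatrix-intro : ∀ x → permMatrix n≤N σ (inject≤ x n≤N) (inject≤ (σ ⟨$⟩ʳ x) n≤N) ≡ true
    permMatrix-intro x = dec-true (any? _) (x , refl , refl)

    permMatrix-elim : ∀ {i j} → permMatrix n≤N σ i j ≡ true →
                      ∃[ x ] inject≤ x n≤N ≡ i × inject≤ (σ ⟨$⟩ʳ x) n≤N ≡ j
    permMatrix-elim = does-elim (any? _)

    contains⇒occurrence : ∀ {k} {π : Permutation′ k} → Contains π (permMatrix n≤N σ) → Occurrence π σ
    contains⇒occurrence {π = π} c = record
      { position   = λ j → proj₁ (wit j)
      ; increasing = λ {j} {l} j<l → subst₂ _<_ (≡row j) (≡row l) (row-increasing j<l)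
      ; sameOrder  = λ j l → mk⇔
          (λ lt → reflect (subst₂ _<_ (sym (≡col j)) (sym (≡col l)) lt))
          (λ lt → subst₂ _<_ (≡col j) (≡col l) (col-increasing lt))
      }
      where
      open Contains c
      wit : ∀ j → ∃[ x ] inject≤ x n≤N ≡ row j × inject≤ (σ ⟨$⟩ʳ x) n≤N ≡ col (π ⟨$⟩ʳ j)
      wit j = permMatrix-elim (entry j)
      ≡row : ∀ j → Fin.toℕ (row j) ≡ Fin.toℕ (proj₁ (wit j))
      ≡row j = trans (cong Fin.toℕ (sym (proj₁ (proj₂ (wit j))))) (toℕ-inject≤ _ n≤N)
      ≡col : ∀ j → Fin.toℕ (col (π ⟨$⟩ʳ j)) ≡ Fin.toℕ (σ ⟨$⟩ʳ proj₁ (wit j))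
      ≡col j = trans (cong Fin.toℕ (sym (proj₂ (proj₂ (wit j))))) (toℕ-inject≤ _ n≤N)
      -- `Contains` supplies only that `col` preserves the order. A strictly increasing map between
      -- linear orders also reflects it, which is the other direction of `sameOrder`.
      reflect : ∀ {x y} → col x Fin.< col y → x Fin.< y
      reflect {x} {y} lt with <-cmp (Fin.toℕ x) (Fin.toℕ y)
      ... | tri< x<y _ _ = x<y
      ... | tri≈ _ x≡y _ = ⊥-elim (<-irrefl (cong (Fin.toℕ ∘ col) (toℕ-injective x≡y)) lt)
      ... | tri> _ _ y<x = ⊥-elim (<-asym lt (col-increasing y<x))

  permMatrix-injective : ∀ {n N} (n≤N : n ≤ N) (σ ρ : Permutation′ n) →
    (∀ i j → permMatrix n≤N σ i j ≡ permMatrix n≤N ρ i j) → σ ≈ ρ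
  permMatrix-injective n≤N σ ρ eq x
    with y , y≡x , ρy≡σx ← permMatrix-elim n≤N ρ (trans (sym (eq _ _)) (permMatrix-intro n≤N σ x))
    with refl ← inject≤-injective n≤N n≤N y x y≡x
    = sym (inject≤-injective n≤N n≤N _ _ ρy≡σx)

  -- The bound is phrased as a code that is injective on avoiders, so that no cardinality has to be
  -- known beforehand. The base collects `B`, the slope `D` and the factor b lost by padding.
  avoiders-exponential : ∀ {k} (π : Permutation′ (suc k)) →
    ∃[ C ] ∀ n → Σ[ code ∈ (Permutation′ (suc n) → Fin (C ℕ.^ suc n)) ]
      (∀ σ ρ → ¬ Occurrence π σ → ¬ Occurrence π ρ → code σ ≡ code ρ → σ ≈ ρ)
  avoiders-exponential {k} π = B ℕ.^ (D * b) , bound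
    where
    b = 2 + k * k
    open StanleyWilf k b _ refl refl
    bound : ∀ n → Σ[ code ∈ (Permutation′ (suc n) → Fin ((B ℕ.^ (D * b)) ℕ.^ suc n)) ]
      (∀ σ ρ → ¬ Occurrence π σ → ¬ Occurrence π ρ → code σ ≡ code ρ → σ ≈ ρ)
    bound n with t , lo , hi ← side-between n = (λ σ → inject≤ (encode t (permMatrix lo σ)) K≤C) ,
      λ σ ρ avσ avρ eq → permMatrix-injective lo σ ρ
        (encode-injective π t _ _ (avσ ∘ contains⇒occurrence lo σ) (avρ ∘ contains⇒occurrence lo ρ)
          (inject≤-injective K≤C K≤C _ _ eq))
      where
      K≤C : K t ≤ (B ℕ.^ (D * b)) ℕ.^ suc n
      K≤C = begin
        K t                     ≤⟨ K≤ t ⟩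
        B ℕ.^ (D * side t)        ≤⟨ ^-monoʳ-≤ B (*-monoʳ-≤ D hi) ⟩
        B ℕ.^ (D * (b * suc n))   ≡⟨ cong (B ℕ.^_) (*-assoc D b (suc n)) ⟨
        B ℕ.^ (D * b * suc n)     ≡⟨ ^-*-assoc B (D * b) (suc n) ⟨
        (B ℕ.^ (D * b)) ℕ.^ suc n   ∎
        where open ≤-Reasoning

-- Direct sums of avoiders and of heaps

module DirectSums where

  open import Data.Fin using (splitAt; _↑ˡ_; _↑ʳ_)
  open import Data.Fin.Properties using
    (toℕ<n; toℕ-↑ˡ; toℕ-↑ʳ; splitAt-↑ˡ; splitAt-↑ʳ; splitAt⁻¹-↑ˡ; splitAt⁻¹-↑ʳ;
     ↑ˡ-injective; ↑ʳ-injective; injective⇒≤)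
  open import Data.Nat using (_+_; _*_; _<_; _<?_)
  open import Data.Nat.Properties
  open import Relation.Nullary using (contradiction)

  data Split p {q} : Fin (p + q) → Set where
    left  : ∀ i → Split p (i ↑ˡ q)
    right : ∀ j → Split p (p ↑ʳ j)

  split : ∀ p {q} (x : Fin (p + q)) → Split p x
  split p {q} x with splitAt p x in eq
  ... | inj₁ i = subst (Split p) (splitAt⁻¹-↑ˡ {p} eq) (left i)
  ... | inj₂ j = subst (Split p) (splitAt⁻¹-↑ʳ {p} eq) (right j)

  module _ {p q : ℕ} where

    ↑ˡ<↑ʳ : ∀ (i : Fin p) (j : Fin q) → i ↑ˡ q Fin.< p ↑ʳ j
    ↑ˡ<↑ʳ i j = subst₂ _<_ (sym (toℕ-↑ˡ i q)) (sym (toℕ-↑ʳ p j))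
      (≤-trans (toℕ<n i) (m≤m+n p (toℕ j)))

    ↑ˡ-<⇔ : ∀ {i j : Fin p} → i ↑ˡ q Fin.< j ↑ˡ q ⇔ i Fin.< j
    ↑ˡ-<⇔ {i} {j} = mk⇔ (subst₂ _<_ (toℕ-↑ˡ i q) (toℕ-↑ˡ j q))
                        (subst₂ _<_ (sym (toℕ-↑ˡ i q)) (sym (toℕ-↑ˡ j q)))

    ↑ʳ-<⇔ : ∀ {i j : Fin q} → p ↑ʳ i Fin.< p ↑ʳ j ⇔ i Fin.< j
    ↑ʳ-<⇔ {i} {j} = mk⇔ (λ lt → +-cancelˡ-< p _ _ (subst₂ _<_ (toℕ-↑ʳ p i) (toℕ-↑ʳ p j) lt))
                        (λ lt → subst₂ _<_ (sym (toℕ-↑ʳ p i)) (sym (toℕ-↑ʳ p j)) (+-monoʳ-< p lt))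

    ↑ˡ≢↑ʳ : ∀ {i : Fin p} {j : Fin q} → i ↑ˡ q ≢ p ↑ʳ j
    ↑ˡ≢↑ʳ {i} {j} eq = <-irrefl (cong toℕ eq) (↑ˡ<↑ʳ i j)

    module _ (α : Permutation′ p) (β : Permutation′ q) where

      ⊕-↑ˡ : ∀ i → (α ⊕ β) ⟨$⟩ʳ (i ↑ˡ q) ≡ (α ⟨$⟩ʳ i) ↑ˡ q
      ⊕-↑ˡ i rewrite splitAt-↑ˡ p i q = refl

      ⊕-↑ʳ : ∀ j → (α ⊕ β) ⟨$⟩ʳ (p ↑ʳ j) ≡ p ↑ʳ (β ⟨$⟩ʳ j)
      ⊕-↑ʳ j rewrite splitAt-↑ʳ p q j = refl

      ⊕-<ˡ : ∀ i j → (α ⊕ β) ⟨$⟩ʳ (i ↑ˡ q) Fin.< (α ⊕ β) ⟨$⟩ʳ (j ↑ˡ q) ⇔ (α ⟨$⟩ʳ i) Fin.< (α ⟨$⟩ʳ j)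
      ⊕-<ˡ i j rewrite ⊕-↑ˡ i | ⊕-↑ˡ j = ↑ˡ-<⇔

      ⊕-<ʳ : ∀ i j → (α ⊕ β) ⟨$⟩ʳ (p ↑ʳ i) Fin.< (α ⊕ β) ⟨$⟩ʳ (p ↑ʳ j) ⇔ (β ⟨$⟩ʳ i) Fin.< (β ⟨$⟩ʳ j)
      ⊕-<ʳ i j rewrite ⊕-↑ʳ i | ⊕-↑ʳ j = ↑ʳ-<⇔

      ⊕-<ˡʳ : ∀ i j → (α ⊕ β) ⟨$⟩ʳ (i ↑ˡ q) Fin.< (α ⊕ β) ⟨$⟩ʳ (p ↑ʳ j)
      ⊕-<ˡʳ i j rewrite ⊕-↑ˡ i | ⊕-↑ʳ j = ↑ˡ<↑ʳ _ _

    ⊕-injective : ∀ {α α′ : Permutation′ p} {β β′ : Permutation′ q} →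
                  α ⊕ β ≈ α′ ⊕ β′ → α ≈ α′ × β ≈ β′
    ⊕-injective {α} {α′} {β} {β′} eq =
      (λ i → ↑ˡ-injective q _ _ (trans (sym (⊕-↑ˡ α β i)) (trans (eq (i ↑ˡ q)) (⊕-↑ˡ α′ β′ i)))) ,
      (λ j → ↑ʳ-injective p _ _ (trans (sym (⊕-↑ʳ α β j)) (trans (eq (p ↑ʳ j)) (⊕-↑ʳ α′ β′ j))))

  too-many : ∀ {n N} (f : Fin (suc n) → Fin N) (g : Fin n → Fin N) →
             Injective _≡_ _≡_ f → ¬ (∀ x → ∃[ y ] f x ≡ g y)
  too-many f g f-inj h = <-irrefl refl (injective⇒≤ {f = proj₁ ∘ h}
    λ {x} {y} eq → f-inj (trans (proj₂ (h x)) (trans (cong g eq) (sym (proj₂ (h y))))))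

  module Separated {p q : ℕ} (τ : Permutation′ (p + q))
                   (sep : ∀ i j → (τ ⟨$⟩ʳ (i ↑ˡ q)) Fin.< (τ ⟨$⟩ʳ (p ↑ʳ j))) where

    -- If a left entry had a value among the top q, so would the q right entries, which exceed it: q
    -- + 1 distinct values in q places.
    low : ∀ i → ∃[ x ] τ ⟨$⟩ʳ (i ↑ˡ q) ≡ x ↑ˡ q
    low i = case-split (split p (τ ⟨$⟩ʳ (i ↑ˡ q))) refl
      where
      f : Fin (suc q) → Fin (p + q)
      f zero    = i ↑ˡ q
      f (suc j) = p ↑ʳ j
      f-inj : Injective _≡_ _≡_ f
      f-inj {zero}  {zero}  _  = refl
      f-inj {zero}  {suc j} eq = ⊥-elim (↑ˡ≢↑ʳ eq)
      f-inj {suc j} {zero}  eq = ⊥-elim (↑ˡ≢↑ʳ (sym eq))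
      f-inj {suc j} {suc l} eq = cong suc (↑ʳ-injective p j l eq)
      case-split : ∀ {v} → Split p v → τ ⟨$⟩ʳ (i ↑ˡ q) ≡ v → ∃[ x ] v ≡ x ↑ˡ q
      case-split (left x)  _  = x , refl
      case-split (right y) eq = ⊥-elim (too-many (λ x → τ ⟨$⟩ʳ f x) (p ↑ʳ_) (f-inj ∘ Injection.injective (↔⇒↣ τ)) high)
        where
        above : ∀ {v} → Split p v → p ↑ʳ y Fin.< v → ∃[ z ] v ≡ p ↑ʳ z
        above (left x)  lt = ⊥-elim (<-asym lt (↑ˡ<↑ʳ x y))
        above (right z) _  = z , refl
        high : ∀ x → ∃[ z ] τ ⟨$⟩ʳ f x ≡ p ↑ʳ z
        high zero    = y , eq
        high (suc j) = above (split p _) (subst (Fin._< _) eq (sep i j))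

    -- The p left entries already occupy the p lowest values, which leaves none for a right entry.
    high : ∀ j → ∃[ y ] τ ⟨$⟩ʳ (p ↑ʳ j) ≡ p ↑ʳ y
    high j = case-split (split p (τ ⟨$⟩ʳ (p ↑ʳ j))) refl
      where
      f : Fin (suc p) → Fin (p + q)
      f zero    = p ↑ʳ j
      f (suc i) = i ↑ˡ q
      f-inj : Injective _≡_ _≡_ f
      f-inj {zero}  {zero}  _  = refl
      f-inj {zero}  {suc j} eq = ⊥-elim (↑ˡ≢↑ʳ (sym eq))
      f-inj {suc j} {zero}  eq = ⊥-elim (↑ˡ≢↑ʳ eq)
      f-inj {suc j} {suc l} eq = cong suc (↑ˡ-injective q j l eq)
      case-split : ∀ {v} → Split p v → τ ⟨$⟩ʳ (p ↑ʳ j) ≡ v → ∃[ y ] v ≡ p ↑ʳ y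
      case-split (right y) _  = y , refl
      case-split (left x)  eq = ⊥-elim (too-many (λ x → τ ⟨$⟩ʳ f x) (_↑ˡ q) (f-inj ∘ Injection.injective (↔⇒↣ τ)) all-low)
        where
        all-low : ∀ x → ∃[ z ] τ ⟨$⟩ʳ f x ≡ z ↑ˡ q
        all-low zero    = x , eq
        all-low (suc i) = low i

    low⁻¹ : ∀ x → ∃[ i ] τ ⟨$⟩ˡ (x ↑ˡ q) ≡ i ↑ˡ q
    low⁻¹ x = case-split (split p (τ ⟨$⟩ˡ (x ↑ˡ q))) refl
      where
      case-split : ∀ {v} → Split p v → τ ⟨$⟩ˡ (x ↑ˡ q) ≡ v → ∃[ i ] v ≡ i ↑ˡ q
      case-split (left i)  _  = i , refl
      case-split (right j) eq = ⊥-elim (↑ˡ≢↑ʳ (trans (sym (inverseʳ τ))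
        (trans (cong (τ ⟨$⟩ʳ_) eq) (proj₂ (high j)))))

    high⁻¹ : ∀ y → ∃[ j ] τ ⟨$⟩ˡ (p ↑ʳ y) ≡ p ↑ʳ j
    high⁻¹ y = case-split (split p (τ ⟨$⟩ˡ (p ↑ʳ y))) refl
      where
      case-split : ∀ {v} → Split p v → τ ⟨$⟩ˡ (p ↑ʳ y) ≡ v → ∃[ j ] v ≡ p ↑ʳ j
      case-split (right j) _  = j , refl
      case-split (left i)  eq = ⊥-elim (↑ˡ≢↑ʳ (trans (sym (proj₂ (low i)))
        (trans (cong (τ ⟨$⟩ʳ_) (sym eq)) (inverseʳ τ))))

    α : Permutation′ p
    α = permutation (proj₁ ∘ low) (proj₁ ∘ low⁻¹)
      (λ x → ↑ˡ-injective q _ _ (trans (sym (proj₂ (low (proj₁ (low⁻¹ x)))))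
        (trans (cong (τ ⟨$⟩ʳ_) (sym (proj₂ (low⁻¹ x)))) (inverseʳ τ))))
      (λ i → ↑ˡ-injective q _ _ (trans (sym (proj₂ (low⁻¹ (proj₁ (low i)))))
        (trans (cong (τ ⟨$⟩ˡ_) (sym (proj₂ (low i)))) (inverseˡ τ))))

    β : Permutation′ q
    β = permutation (proj₁ ∘ high) (proj₁ ∘ high⁻¹)
      (λ y → ↑ʳ-injective p _ _ (trans (sym (proj₂ (high (proj₁ (high⁻¹ y)))))
        (trans (cong (τ ⟨$⟩ʳ_) (sym (proj₂ (high⁻¹ y)))) (inverseʳ τ))))
      (λ j → ↑ʳ-injective p _ _ (trans (sym (proj₂ (high⁻¹ (proj₁ (high j)))))
        (trans (cong (τ ⟨$⟩ˡ_) (sym (proj₂ (high j)))) (inverseˡ τ))))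

    ≈⊕ : τ ≈ α ⊕ β
    ≈⊕ x with split p x
    ... | left i  = trans (proj₂ (low i)) (sym (⊕-↑ˡ α β i))
    ... | right j = trans (proj₂ (high j)) (sym (⊕-↑ʳ α β j))

  -- The length q of the complement is returned as well: matching on `p + q ≡ s` gives a permutation
  -- of size s the type that `decompose` expects.
  threshold : ∀ {s} {P : Fin s → Set} → Decidable P → (∀ {i j} → i Fin.< j → P j → P i) →
              ∃₂ λ p q → p + q ≡ s × (∀ j → toℕ j < p ⇔ P j)
  threshold {zero}  P? down = 0 , 0 , refl , λ ()
  threshold {suc s} {P} P? down with P? zero
  ... | no ¬P0 = 0 , suc s , refl , none
    where
    none : ∀ j → toℕ j < 0 ⇔ P j
    none j = mk⇔ (λ ()) (λ Pj → ⊥-elim (¬P0 (P0 j Pj)))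
      where
      P0 : ∀ j → P j → P zero
      P0 zero    Pj = Pj
      P0 (suc j) Pj = down (s≤s z≤n) Pj
  ... | yes P0 with p , q , p+q≡s , iff ← threshold (P? ∘ suc) (down ∘ s≤s) = suc p , q , cong suc p+q≡s , iff′
    where
    iff′ : ∀ j → toℕ j < suc p ⇔ P j
    iff′ zero    = mk⇔ (λ _ → P0) (λ _ → s≤s z≤n)
    iff′ (suc j) = mk⇔ (Equivalence.to (iff j) ∘ s≤s⁻¹) (s≤s ∘ Equivalence.from (iff j))

  -- Here `f` is the inclusion of one summand, and the last hypothesis says that the whole
  -- occurrence falls into it.
  restrict : ∀ {s n N} {τ : Permutation′ s} {σ : Permutation′ n} {ρ : Permutation′ N}
             (o : Occurrence τ ρ) (f : Fin n → Fin N) →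
             (∀ {x y} → f x Fin.< f y → x Fin.< y) →
             (∀ x y → (ρ ⟨$⟩ʳ f x) Fin.< (ρ ⟨$⟩ʳ f y) ⇔ (σ ⟨$⟩ʳ x) Fin.< (σ ⟨$⟩ʳ y)) →
             (∀ j → ∃[ x ] Occurrence.position o j ≡ f x) → Occurrence τ σ
  restrict {τ = τ} {σ} {ρ} o f reflects order g = record
    { position   = proj₁ ∘ g
    ; increasing = λ {j} {l} j<l → reflects (subst₂ Fin._<_ (proj₂ (g j)) (proj₂ (g l)) (increasing j<l))
    ; sameOrder  = λ j l → mk⇔
        (λ lt → Equivalence.to (sameOrder j l) (subst₂ ρ< (sym (proj₂ (g j))) (sym (proj₂ (g l)))
          (Equivalence.from (order _ _) lt)))
        (λ lt → Equivalence.to (order _ _) (subst₂ ρ< (proj₂ (g j)) (proj₂ (g l))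
          (Equivalence.from (sameOrder j l) lt)))
    }
    where
    open Occurrence o
    ρ< : Fin _ → Fin _ → Set
    ρ< x y = (ρ ⟨$⟩ʳ x) Fin.< (ρ ⟨$⟩ʳ y)

  -- The positions of an occurrence that lie in the first summand form an initial
  -- segment; if it is proper and nonempty, it exhibits τ as a direct sum.
  ⊕-avoids : ∀ {s ℓ m} {τ : Permutation′ s} → SumIndecomposable τ →
             (α : Permutation′ ℓ) (β : Permutation′ m) →
             ¬ Occurrence τ α → ¬ Occurrence τ β → ¬ Occurrence τ (α ⊕ β)
  ⊕-avoids {s} {ℓ} {m} {τ} indec α β avα avβ o
    with p , q , eq , iff ← threshold (λ j → toℕ (Occurrence.position o j) <? ℓ)
                              (λ i<j → <-trans (Occurrence.increasing o i<j))
    = by-cases p q eq iff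
    where
    Low : ∀ {s} {τ : Permutation′ s} → Occurrence τ (α ⊕ β) → Fin s → Set
    Low o j = toℕ (Occurrence.position o j) < ℓ
    inα : ∀ (x : Fin (ℓ + m)) → toℕ x < ℓ → ∃[ y ] x ≡ y ↑ˡ m
    inα x lt with split ℓ x
    ... | left i  = i , refl
    ... | right j = ⊥-elim (<⇒≱ (subst (_< ℓ) (toℕ-↑ʳ ℓ j) lt) (m≤m+n ℓ (toℕ j)))
    inβ : ∀ (x : Fin (ℓ + m)) → ¬ (toℕ x < ℓ) → ∃[ y ] x ≡ ℓ ↑ʳ y
    inβ x nlt with split ℓ x
    ... | left i  = ⊥-elim (nlt (subst (_< ℓ) (sym (toℕ-↑ˡ i m)) (toℕ<n i)))
    ... | right j = j , refl
    both : ∀ {p q} .{{_ : NonZero p}} .{{_ : NonZero q}} (τ : Permutation′ (p + q))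
           (o : Occurrence τ (α ⊕ β)) → (∀ j → toℕ j < p ⇔ Low o j) → SumDecomposable τ
    both {p} {q} τ o iff = decompose S.α S.β S.≈⊕
      where
      open Occurrence o
      -- Left positions land in `α`, right ones in `β`, where all values are larger; `sameOrder`
      -- carries this back to `τ`.
      sep : ∀ i j → (τ ⟨$⟩ʳ (i ↑ˡ q)) Fin.< (τ ⟨$⟩ʳ (p ↑ʳ j))
      sep i j with x , x≡ ← inα (position (i ↑ˡ q))
                              (Equivalence.to (iff _) (subst (_< p) (sym (toℕ-↑ˡ i q)) (toℕ<n i)))
              with y , y≡ ← inβ (position (p ↑ʳ j))
                              (λ lt → <⇒≱ (subst (_< p) (toℕ-↑ʳ p j) (Equivalence.from (iff _) lt)) (m≤m+n p (toℕ j)))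
        = Equivalence.to (sameOrder _ _)
            (subst₂ (λ u v → ((α ⊕ β) ⟨$⟩ʳ u) Fin.< ((α ⊕ β) ⟨$⟩ʳ v)) (sym x≡) (sym y≡) (⊕-<ˡʳ α β x y))
      module S = Separated τ sep
    by-cases : ∀ p q → p + q ≡ s → (∀ j → toℕ j < p ⇔ Low o j) → ⊥
    by-cases zero q eq iff = avβ (restrict o (ℓ ↑ʳ_) (Equivalence.to ↑ʳ-<⇔) (⊕-<ʳ α β)
      (λ j → inβ _ (λ lt → contradiction (Equivalence.from (iff j) lt) λ ())))
    by-cases (suc p) zero eq iff = avα (restrict o (_↑ˡ m) (Equivalence.to ↑ˡ-<⇔) (⊕-<ˡ α β)
      (λ j → inα _ (Equivalence.to (iff j)
        (subst (toℕ j <_) (trans (sym eq) (+-identityʳ (suc p))) (toℕ<n j)))))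
    by-cases (suc p) (suc q) refl iff = indec (both τ o iff)

  -- The children of a vertex in the second summand would have index at least
  -- 2 ℓ + 1 ≥ ℓ + m.
  ⊕-heap : ∀ {k ℓ m} → 2 ≤ k → m ≤ suc ℓ → (α : Permutation′ ℓ) (β : Permutation′ m) →
           IsHeap k α → IsHeap k (α ⊕ β)
  ⊕-heap {k} {ℓ} {m} 2≤k m≤ α β heap x y (lo , hi) with split ℓ x | split ℓ y
  ... | left i  | left j  = Equivalence.from (⊕-<ˡ α β i j) (heap i j
    (subst₂ (λ u v → k * u + 2 ≤ suc v) (toℕ-↑ˡ i m) (toℕ-↑ˡ j m) lo ,
     subst₂ (λ u v → suc v ≤ k * suc u + 1) (toℕ-↑ˡ i m) (toℕ-↑ˡ j m) hi))
  ... | left i  | right j = ⊕-<ˡʳ α β i j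
  ... | right i | y′      = ⊥-elim (<⇒≱ (toℕ<n y) (s≤s⁻¹ (begin
    suc (ℓ + m)           ≤⟨ s≤s (+-monoʳ-≤ ℓ m≤) ⟩
    suc (ℓ + suc ℓ)       ≡⟨ cong suc (+-suc ℓ ℓ) ⟩
    suc (suc (ℓ + ℓ))     ≡⟨ +-comm 2 (ℓ + ℓ) ⟩
    (ℓ + ℓ) + 2           ≡⟨ cong (λ z → ℓ + z + 2) (+-identityʳ ℓ) ⟨
    2 * ℓ + 2             ≤⟨ +-monoˡ-≤ 2 (*-mono-≤ 2≤k (m≤m+n ℓ (toℕ i))) ⟩
    k * (ℓ + toℕ i) + 2   ≡⟨ cong (λ z → k * z + 2) (toℕ-↑ʳ ℓ i) ⟨
    k * toℕ (ℓ ↑ʳ i) + 2  ≤⟨ lo ⟩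
    suc (toℕ y)           ∎)))
    where open ≤-Reasoning

-- Cardinalities and the inequalities between them

module Counting where

  open PatternMatrices using (funToFin-injective; avoiders-exponential)
  open DirectSums
  open import Data.Fin using (funToFin; combine; remQuot)
  open import Data.Fin.Properties using (injective⇒≤; suc-injective; toℕ<n; combine-remQuot)
  open import Data.Nat using (_+_; _*_)
  open import Data.Nat.Properties using (≤-<-trans; <-irrefl)

  funToFin-cong : ∀ {m n} {f g : Fin m → Fin n} → f ≗ g → funToFin f ≡ funToFin g
  funToFin-cong {zero}  f≗g = refl
  funToFin-cong {suc m} f≗g = cong₂ combine (f≗g zero) (funToFin-cong (f≗g ∘ suc))

  enumerate : ∀ {N} {Q : Fin N → Set} → Decidable Q →
    ∃[ c ] Σ[ e ∈ (Fin c → Fin N) ] Injective _≡_ _≡_ e × (∀ i → Q (e i)) × (∀ v → Q v → ∃[ i ] e i ≡ v)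
  enumerate {zero}  Q? = 0 , (λ ()) , (λ { {()} }) , (λ ()) , λ ()
  enumerate {suc N} {Q} Q? with Q? zero | enumerate (Q? ∘ suc)
  ... | no ¬Q0 | c , e , e-inj , Qe , index = c , suc ∘ e , e-inj ∘ suc-injective , Qe , index′
    where
    index′ : ∀ v → Q v → ∃[ i ] suc (e i) ≡ v
    index′ zero    Qv = ⊥-elim (¬Q0 Qv)
    index′ (suc v) Qv with i , eq ← index v Qv = i , cong suc eq
  ... | yes Q0 | c , e , e-inj , Qe , index = suc c , e′ , e′-inj , Qe′ , index′
    where
    e′ : Fin (suc c) → Fin (suc N)
    e′ zero    = zero
    e′ (suc i) = suc (e i)
    e′-inj : Injective _≡_ _≡_ e′
    e′-inj {zero}  {zero}  _  = refl
    e′-inj {suc i} {suc j} eq = cong suc (e-inj (suc-injective eq))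
    Qe′ : ∀ i → Q (e′ i)
    Qe′ zero    = Q0
    Qe′ (suc i) = Qe i
    index′ : ∀ v → Q v → ∃[ i ] e′ i ≡ v
    index′ zero    Qv = zero , refl
    index′ (suc v) Qv with i , eq ← index v Qv = suc i , cong suc eq

  -- The cardinality is the number of attained codes, and excluded middle decides which codes are
  -- attained. The proof that a code is attained contains the element to which the inverse sends it.
  finite-cardinality : ExcludedMiddle 0ℓ → (S : Setoid 0ℓ 0ℓ) → let open Setoid S using (Carrier) renaming (_≈_ to _∼_) in
    ∀ {N} (code : Carrier → Fin N) → (∀ {x y} → x ∼ y → code x ≡ code y) →
    (∀ {x y} → code x ≡ code y → x ∼ y) → ∃[ c ] HasCardinality S c
  finite-cardinality em S code cong-code inj-code
    with c , e , e-inj , Qe , index ← enumerate {Q = λ v → ∃[ x ] code x ≡ v} (λ _ → em)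
    = c , record
      { to        = to
      ; from      = from
      ; to-cong   = λ {x} {y} x∼y → e-inj (trans (e-to x) (trans (cong-code x∼y) (sym (e-to y))))
      ; from-cong = λ { refl → S.refl }
      ; inverse   = (λ {i} {x} x∼ → e-inj (trans (e-to x) (trans (cong-code x∼) (proj₂ (Qe i)))))
                  , (λ {x} {i} i≡ → inj-code (trans (proj₂ (Qe i)) (trans (cong e i≡) (e-to x))))
      }
    where
    module S = Setoid S
    to : S.Carrier → Fin c
    to x = proj₁ (index (code x) (x , refl))
    e-to : ∀ x → e (to x) ≡ code x
    e-to x = proj₂ (index (code x) (x , refl))
    from : Fin c → S.Carrier
    from i = proj₁ (Qe i)

  PermsWith-cardinality : ExcludedMiddle 0ℓ → ∀ n (P : Permutation′ n → Set) →
                          ∃[ c ] HasCardinality (PermsWith n P) c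
  PermsWith-cardinality em n P =
    finite-cardinality em (PermsWith n P) (λ (σ , _) → funToFin (σ ⟨$⟩ʳ_)) funToFin-cong funToFin-injective

  to-injective : ∀ {S T : Setoid 0ℓ 0ℓ} (I : Inverse S T) {x y} →
                 Setoid._≈_ T (Inverse.to I x) (Inverse.to I y) → Setoid._≈_ S x y
  to-injective I = Injection.injective (Inverse⇒Injection I)

  from-injective : ∀ {S T : Setoid 0ℓ 0ℓ} (I : Inverse S T) {x y} →
                   Setoid._≈_ S (Inverse.from I x) (Inverse.from I y) → Setoid._≈_ T x y
  from-injective I = to-injective (inverse-sym I)

  module _ {S : Setoid 0ℓ 0ℓ} {c : ℕ} (#S : HasCardinality S c) where
    open Setoid S using () renaming (Carrier to X; _≈_ to _∼_)
    open Inverse #S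

    card-nonempty : X → 1 ≤ c
    card-nonempty x = ≤-<-trans z≤n (toℕ<n (to x))

    card-inhabitant : 1 ≤ c → X
    card-inhabitant (s≤s _) = from zero

    card-≤-code : ∀ {K} (code : X → Fin K) → (∀ {x y} → code x ≡ code y → x ∼ y) → c ≤ K
    card-≤-code code inj = injective⇒≤ {f = code ∘ from} (from-injective #S ∘ inj)

  card-≤ : ∀ {S T : Setoid 0ℓ 0ℓ} {c d} → HasCardinality S c → HasCardinality T d →
           (f : Setoid.Carrier S → Setoid.Carrier T) →
           (∀ {x y} → Setoid._≈_ T (f x) (f y) → Setoid._≈_ S x y) → c ≤ d
  card-≤ #S #T f f-inj = card-≤-code #S (Inverse.to #T ∘ f) (f-inj ∘ to-injective #T)

  card-* : ∀ {S T U : Setoid 0ℓ 0ℓ} {c d e} → HasCardinality S c → HasCardinality T d → HasCardinality U e →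
           (f : Setoid.Carrier S → Setoid.Carrier T → Setoid.Carrier U) →
           (∀ {x x′ y y′} → Setoid._≈_ U (f x y) (f x′ y′) → Setoid._≈_ S x x′ × Setoid._≈_ T y y′) →
           c * d ≤ e
  card-* {c = c} {d} #S #T #U f f-inj = injective⇒≤ {f = g} g-inj
    where
    pair : Fin (c * d) → Fin c × Fin d
    pair = remQuot {c} d
    g : Fin (c * d) → Fin _
    g i = Inverse.to #U (f (Inverse.from #S (proj₁ (pair i))) (Inverse.from #T (proj₂ (pair i))))
    g-inj : Injective _≡_ _≡_ g
    g-inj {i} {j} eq with s , t ← f-inj (to-injective #U eq) =
      trans (sym (combine-remQuot {c} d i))
        (trans (cong₂ combine (from-injective #S s) (from-injective #T t))
               (combine-remQuot {c} d j))

  -- This is the whole interface between combinatorics and analysis. `h-super` inherits its size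
  -- condition from `⊕-heap`; `a1` separates the degenerate case, in which there are no avoiders of
  -- positive size at all.
  record Growth (a h : ℕ → ℕ) : Set where
    field
      h≤a      : ∀ n → h n ≤ a n
      a-super  : ∀ ℓ m → a ℓ * a m ≤ a (ℓ + m)
      h-super  : ∀ ℓ m → m ≤ suc ℓ → h ℓ * a m ≤ h (ℓ + m)
      h0       : 1 ≤ h 0
      a1       : ∀ n → 1 ≤ a (suc n) → 1 ≤ a 1
      base     : ℕ
      a-bound  : ∀ n → a (suc n) ≤ base ℕ.^ suc n

  someIndex : ∀ s → Index s
  someIndex (finite (suc r)) = zero
  someIndex infinite         = 0

  no-empty-occurrence : ∀ (π : Pattern) {σ : Permutation′ 0} → ¬ Occurrence (perm π) σ
  no-empty-occurrence record { size = suc m } o with () ← Occurrence.position o zero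

  Av-exponential : ∀ (π : Pattern) →
    ∃[ C ] ∀ n → Σ[ code ∈ (Permutation′ (suc n) → Fin (C ℕ.^ suc n)) ]
      (∀ σ ρ → ¬ Occurrence (perm π) σ → ¬ Occurrence (perm π) ρ → code σ ≡ code ρ → σ ≈ ρ)
  Av-exponential record { size = suc m ; perm = π } = avoiders-exponential π

  module Cardinalities (em : ExcludedMiddle 0ℓ) (k : ℕ) (2≤k : 2 ≤ k) {s : SeqLength} (τ : PatternSeq s)
                       (indec : ∀ i → SumIndecomposable (perm (τ i))) where

    a h : ℕ → ℕ
    a n = proj₁ (PermsWith-cardinality em n (Avoids τ))
    h n = proj₁ (PermsWith-cardinality em n (λ σ → IsHeap k σ × Avoids τ σ))

    #Av : ∀ n → HasCardinality (Av n τ) (a n)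
    #Av n = proj₂ (PermsWith-cardinality em n (Avoids τ))

    #𝓗 : ∀ n → HasCardinality (𝓗 k n τ) (h n)
    #𝓗 n = proj₂ (PermsWith-cardinality em n (λ σ → IsHeap k σ × Avoids τ σ))

    i₀ : Index s
    i₀ = someIndex s

    -- Whatever avoids the whole sequence avoids its member at `i₀`, so the bound for a single
    -- pattern is enough.
    exponential : ∃[ C ] ∀ n → a (suc n) ≤ C ℕ.^ suc n
    exponential with C , code ← Av-exponential (τ i₀) = C , λ n →
      card-≤-code (#Av (suc n)) (λ (σ , _) → proj₁ (code n) σ)
        (λ {(σ , avσ)} {(ρ , avρ)} → proj₂ (code n) σ ρ (avσ i₀) (avρ i₀))

    growth : Growth a h
    growth = record
      { h≤a     = λ n → card-≤ (#𝓗 n) (#Av n) (λ (σ , _ , av) → σ , av) (λ eq → eq)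
      ; a-super = λ ℓ m → card-* (#Av ℓ) (#Av m) (#Av (ℓ + m))
          (λ (α , avα) (β , avβ) → α ⊕ β , λ i → ⊕-avoids (indec i) α β (avα i) (avβ i))
          (λ {(α , _)} {(α′ , _)} {(β , _)} {(β′ , _)} → ⊕-injective {α = α} {α′} {β} {β′})
      ; h-super = λ ℓ m m≤ → card-* (#𝓗 ℓ) (#Av m) (#𝓗 (ℓ + m))
          (λ (α , heap , avα) (β , avβ) → α ⊕ β , ⊕-heap 2≤k m≤ α β heap ,
            λ i → ⊕-avoids (indec i) α β (avα i) (avβ i))
          (λ {(α , _)} {(α′ , _)} {(β , _)} {(β′ , _)} → ⊕-injective {α = α} {α′} {β} {β′})
      ; h0      = card-nonempty (#𝓗 0) (idₚ , (λ ()) , λ i → no-empty-occurrence (τ i))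
      ; a1      = λ n 1≤a → card-nonempty (#Av 1)
          (idₚ , λ i o → proj₂ (card-inhabitant (#Av (suc n)) 1≤a) i (spread o))
      ; base    = proj₁ exponential
      ; a-bound = proj₂ exponential
      }
      where
      -- A pattern that occurs in the permutation of size 1 has at most one point, so it occurs at
      -- the first position of every nonempty permutation.
      spread : ∀ {m n} {π : Permutation′ m} {σ : Permutation′ (suc n)} → Occurrence π (idₚ {1}) → Occurrence π σ
      spread {σ = σ} o = record
        { position   = λ _ → zero
        ; increasing = λ {j} {l} j<l → ⊥-elim (no< _ _ (increasing j<l))
        ; sameOrder  = λ j l → mk⇔ (λ lt → ⊥-elim (<-irrefl refl lt))
                                   (λ lt → ⊥-elim (no< _ _ (Equivalence.from (sameOrder j l) lt)))
        }
        where
        open Occurrence o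
        no< : ∀ (x y : Fin 1) → ¬ x Fin.< y
        no< zero zero ()

-- From the inequalities to the growth rates

module Limits where

  open Counting using (Growth)
  open import Algebra.Bundles using (CommutativeRing)
  import Data.Integer as ℤ
  import Data.Integer.Properties as ℤ
  open import Data.Nat.Coprimality using (1-coprimeTo) renaming (sym to coprime-sym)
  open import Data.Nat.Induction using (<-rec)
  open import Data.Rational
    using (ℚ; mkℚ; 0ℚ; 1ℚ; ½; _<_; _+_; _*_; _-_; -_; 1/_; *≤*; *<*; _/_; _<?_; positive; nonNegative)
    renaming (_≤_ to _≤ᵠ_)
  open import Data.Rational.Properties
  open import Data.Rational.Solver using (module +-*-Solver)
  open import Algebra.Properties.Semiring.Exp (CommutativeRing.semiring +-*-commutativeRing) using (^-homo-*)

  fromℕ≡mkℚ : ∀ n → fromℕ n ≡ mkℚ (ℤ.+ n) 0 (coprime-sym (1-coprimeTo n))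
  fromℕ≡mkℚ n = normalize-coprime (coprime-sym (1-coprimeTo n))

  fromℕ-+ : ∀ m n → fromℕ (m ℕ.+ n) ≡ fromℕ m + fromℕ n
  fromℕ-+ m n rewrite fromℕ≡mkℚ m | fromℕ≡mkℚ n =
    cong (_/ 1) (sym (cong₂ ℤ._+_ (ℤ.*-identityʳ (ℤ.+ m)) (ℤ.*-identityʳ (ℤ.+ n))))

  fromℕ-* : ∀ m n → fromℕ (m ℕ.* n) ≡ fromℕ m * fromℕ n
  fromℕ-* m n rewrite fromℕ≡mkℚ m | fromℕ≡mkℚ n = cong (_/ 1) (ℤ.pos-* m n)

  fromℕ-^ : ∀ m n → fromℕ (m ℕ.^ n) ≡ fromℕ m ^ n
  fromℕ-^ m zero    = refl
  fromℕ-^ m (suc n) = trans (fromℕ-* m (m ℕ.^ n)) (cong (fromℕ m *_) (fromℕ-^ m n))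

  fromℕ-mono : ∀ {m n} → m ≤ n → fromℕ m ≤ᵠ fromℕ n
  fromℕ-mono {m} {n} m≤n rewrite fromℕ≡mkℚ m | fromℕ≡mkℚ n =
    *≤* (ℤ.*-monoʳ-≤-nonNeg (ℤ.+ 1) (ℤ.+≤+ m≤n))

  archimedean : ∀ q → ∃[ N ] q < fromℕ N
  archimedean q@(mkℚ z d _) = suc ℤ.∣ z ∣ , subst (q <_) (sym (fromℕ≡mkℚ (suc ℤ.∣ z ∣))) (*<* (begin-strict
    z ℤ.* ℤ.+ 1                      ≡⟨ ℤ.*-identityʳ z ⟩
    z                                ≤⟨ ≤∣∣ z ⟩
    ℤ.+ ℤ.∣ z ∣                      <⟨ ℤ.+<+ (ℕ.n<1+n ℤ.∣ z ∣) ⟩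
    ℤ.+ suc ℤ.∣ z ∣                  ≤⟨ ℤ.+≤+ (ℕ.m≤m*n (suc ℤ.∣ z ∣) (suc d)) ⟩
    ℤ.+ (suc ℤ.∣ z ∣ ℕ.* suc d)      ≡⟨ ℤ.pos-* (suc ℤ.∣ z ∣) (suc d) ⟩
    ℤ.+ suc ℤ.∣ z ∣ ℤ.* ℤ.+ suc d    ∎))
    where
    open ℤ.≤-Reasoning
    ≤∣∣ : ∀ z → z ℤ.≤ ℤ.+ ℤ.∣ z ∣
    ≤∣∣ (ℤ.+ n)      = ℤ.≤-refl
    ≤∣∣ (ℤ.-[1+ n ]) = ℤ.-≤+

  abstract

    archimedean-multiple : ∀ {d} → 0ℚ < d → ∀ q → ∃[ N ] q < fromℕ N * d
    archimedean-multiple {d} 0<d q = N ,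
      subst₂ _<_ (x*b/x d 0<d q) (*-comm d (fromℕ N)) (*-monoʳ-<-pos d {{positive 0<d}} (proj₂ large))
      where
      large : ∃[ N ] 1/_ d {{pos⇒nonZero d {{positive 0<d}}}} * q < fromℕ N
      large = archimedean _
      N : ℕ
      N = proj₁ large

  0<1 : 0ℚ < 1ℚ
  0<1 = positive⁻¹ 1ℚ

  1^ : ∀ n → 1ℚ ^ n ≡ 1ℚ
  1^ zero    = refl
  1^ (suc n) = trans (*-identityˡ (1ℚ ^ n)) (1^ n)

  *-mono : ∀ {p q r s} → 0ℚ ≤ᵠ p → 0ℚ ≤ᵠ s → p ≤ᵠ q → r ≤ᵠ s → p * r ≤ᵠ q * s
  *-mono 0≤p 0≤s p≤q r≤s = ≤-trans (*-monoˡ 0≤p r≤s) (*-monoʳ 0≤s p≤q)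

  ^-mono-exp : ∀ {q m n} → 1ℚ ≤ᵠ q → m ≤ n → q ^ m ≤ᵠ q ^ n
  ^-mono-exp {q} {n = n} 1≤q z≤n = 1≤^ n 1≤q
  ^-mono-exp {q} 1≤q (s≤s m≤n) = *-monoˡ (≤-trans (<⇒≤ 0<1) 1≤q) (^-mono-exp 1≤q m≤n)

  -- Bernoulli's inequality for (1 + d / y) ^ n, multiplied by y ^ suc n.
  bernoulli : ∀ {y d} → 0ℚ ≤ᵠ y → 0ℚ ≤ᵠ d → ∀ n → y ^ n * (fromℕ n * d) ≤ᵠ y * (y + d) ^ n
  bernoulli {y} {d} 0≤y 0≤d zero = begin
    1ℚ * (0ℚ * d)  ≡⟨ trans (*-identityˡ (0ℚ * d)) (*-zeroˡ d) ⟩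
    0ℚ             ≤⟨ 0≤y ⟩
    y              ≡⟨ *-identityʳ y ⟨
    y * 1ℚ         ∎
    where open ≤-Reasoning
  bernoulli {y} {d} 0≤y 0≤d (suc n) = begin
    y * y ^ n * (fromℕ (suc n) * d)          ≡⟨ cong (λ z → y * y ^ n * (z * d)) (fromℕ-+ 1 n) ⟩
    y * y ^ n * ((1ℚ + fromℕ n) * d)         ≡⟨ expand y (y ^ n) (fromℕ n) d ⟩
    y * (y ^ n * (fromℕ n * d)) + y * d * y ^ n
      ≤⟨ +-mono-≤ (*-monoˡ 0≤y (bernoulli 0≤y 0≤d n)) (*-monoˡ (0≤* 0≤y 0≤d) (^-mono n 0≤y y≤y+d)) ⟩
    y * (y * (y + d) ^ n) + y * d * (y + d) ^ n  ≡⟨ collect y d ((y + d) ^ n) ⟩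
    y * ((y + d) * (y + d) ^ n)              ∎
    where
    open ≤-Reasoning
    y≤y+d : y ≤ᵠ y + d
    y≤y+d = subst (_≤ᵠ y + d) (+-identityʳ y) (+-monoʳ-≤ y 0≤d)
    open +-*-Solver
    expand : ∀ y Y m d → y * Y * ((1ℚ + m) * d) ≡ y * (Y * (m * d)) + y * d * Y
    expand = solve 4 (λ y Y m d → y :* Y :* ((con 1ℚ :+ m) :* d) := y :* (Y :* (m :* d)) :+ y :* d :* Y) refl
    collect : ∀ y d X → y * (y * X) + y * d * X ≡ y * ((y + d) * X)
    collect = solve 3 (λ y d X → y :* (y :* X) :+ y :* d :* X := y :* ((y :+ d) :* X)) refl

  abstract

    -- With d = x - y, Bernoulli's inequality bounds y * x ^ n below by y ^ n * (n * d), which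
    -- exceeds y ^ n * (D * y) as soon as n * d > D * y. Every constant factor met below is absorbed
    -- in this way.
    exponential-gap : ∀ {x y} D → 0ℚ < y → y < x → ∃[ N ] (∀ n → N ≤ n → D * y ^ n < x ^ n)
    exponential-gap {x} {y} D 0<y y<x = N , λ n N≤n → *-cancelˡ-<-nonNeg y {{nonNegative (<⇒≤ 0<y)}} (begin-strict
        y * (D * y ^ n)          ≡⟨ rearrange y D (y ^ n) ⟩
        y ^ n * (D * y)          <⟨ *-monoʳ-<-pos (y ^ n) {{positive (0<^ n 0<y)}} (<-≤-trans Dy<Nd (*-monoʳ (<⇒≤ 0<d) (fromℕ-mono N≤n))) ⟩
        y ^ n * (fromℕ n * d)    ≤⟨ bernoulli (<⇒≤ 0<y) (<⇒≤ 0<d) n ⟩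
        y * (y + d) ^ n          ≡⟨ cong (λ z → y * z ^ n) (y+d≡x y x) ⟩
        y * x ^ n                ∎)
      where
      open ≤-Reasoning
      d : ℚ
      d = x - y
      0<d : 0ℚ < d
      0<d = subst (_< d) (+-inverseʳ y) (+-monoˡ-< (- y) y<x)
      N : ℕ
      N = proj₁ (archimedean-multiple 0<d (D * y))
      Dy<Nd : D * y < fromℕ N * d
      Dy<Nd = proj₂ (archimedean-multiple 0<d (D * y))
      open +-*-Solver
      rearrange : ∀ y D Y → y * (D * Y) ≡ Y * (D * y)
      rearrange = solve 3 (λ y D Y → y :* (D :* Y) := Y :* (D :* y)) refl
      y+d≡x : ∀ y x → y + (x - y) ≡ x
      y+d≡x = solve 2 (λ y x → y :+ (x :- y) := x) refl

  module _ {a h : ℕ → ℕ} (g : Growth a h) where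
    open Growth g

    A H : ℕ → ℚ
    A n = fromℕ (a n)
    H n = fromℕ (h n)

    A-super : ∀ m n → A m * A n ≤ᵠ A (m ℕ.+ n)
    A-super m n = ≤-trans (≤-reflexive (sym (fromℕ-* (a m) (a n)))) (fromℕ-mono (a-super m n))

    h-halves : ∀ n → h ⌊ n /2⌋ ℕ.* a ⌈ n /2⌉ ≤ h n
    h-halves n = subst (λ z → h ⌊ n /2⌋ ℕ.* a ⌈ n /2⌉ ≤ h z) (ℕ.⌊n/2⌋+⌈n/2⌉≡n n)
                       (h-super ⌊ n /2⌋ ⌈ n /2⌉ (⌈/2⌉≤1+⌊/2⌋ n))
      where
      -- For odd n the second half is longer by one, which is exactly the slack that `h-super`
      -- allows.
      ⌈/2⌉≤1+⌊/2⌋ : ∀ n → ⌈ n /2⌉ ≤ suc ⌊ n /2⌋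
      ⌈/2⌉≤1+⌊/2⌋ zero          = z≤n
      ⌈/2⌉≤1+⌊/2⌋ (suc zero)    = s≤s z≤n
      ⌈/2⌉≤1+⌊/2⌋ (suc (suc n)) = s≤s (⌈/2⌉≤1+⌊/2⌋ n)

    H-halves : ∀ n → H ⌊ n /2⌋ * A ⌈ n /2⌉ ≤ᵠ H n
    H-halves n = ≤-trans (≤-reflexive (sym (fromℕ-* (h ⌊ n /2⌋) (a ⌈ n /2⌉)))) (fromℕ-mono (h-halves n))

    1≤a1-from : ∀ {y} m .{{_ : NonZero m}} → 0ℚ ≤ᵠ y → y ^ m < A m → 1 ≤ a 1
    1≤a1-from (suc m) 0≤y yᵐ<A = a1 m (ℕ.n≢0⇒n>0 λ a≡0 →
      <-irrefl refl (≤-<-trans (0≤^ (suc m) 0≤y) (subst (λ z → _ < fromℕ z) a≡0 yᵐ<A)))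

    module _ (1≤a1 : 1 ≤ a 1) where

      1≤h : ∀ n → 1 ≤ h n
      1≤a : ∀ n → 1 ≤ a n
      1≤a zero    = ℕ.≤-trans h0 (h≤a 0)
      1≤a (suc n) = ℕ.≤-trans (ℕ.*-mono-≤ 1≤a1 (1≤a n)) (a-super 1 n)
      1≤h = <-rec (λ n → 1 ≤ h n) step
        where
        step : ∀ n → (∀ {m} → m ℕ.< n → 1 ≤ h m) → 1 ≤ h n
        step zero    ih = h0
        step (suc n) ih = ℕ.≤-trans (ℕ.*-mono-≤ (ih (ℕ.⌊n/2⌋<n n)) (1≤a ⌈ suc n /2⌉)) (h-halves (suc n))

    -- Strong induction removes m at a time, each time gaining A m ≥ x ^ m. The factor x ^ m is paid
    -- once, for the remainder below m, where only A n ≥ 1 is known.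
    A-lower : ∀ {x m} .{{_ : NonZero m}} → 1 ≤ a 1 → 1ℚ ≤ᵠ x → x ^ m ≤ᵠ A m → ∀ n → x ^ n ≤ᵠ x ^ m * A n
    A-lower {x} {m} 1≤a1 1≤x xᵐ≤A = <-rec (λ n → x ^ n ≤ᵠ x ^ m * A n) step
      where
      open ≤-Reasoning
      0≤x : 0ℚ ≤ᵠ x
      0≤x = ≤-trans (<⇒≤ 0<1) 1≤x
      open +-*-Solver
      rearrange : ∀ p q r → p * (q * r) ≡ q * (p * r)
      rearrange = solve 3 (λ p q r → p :* (q :* r) := q :* (p :* r)) refl
      step : ∀ n → (∀ {i} → i ℕ.< n → x ^ i ≤ᵠ x ^ m * A i) → x ^ n ≤ᵠ x ^ m * A n
      step n ih with m ℕ.≤? n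
      ... | no m≰n = begin
        x ^ n          ≤⟨ ^-mono-exp 1≤x (ℕ.<⇒≤ (ℕ.≰⇒> m≰n)) ⟩
        x ^ m          ≡⟨ *-identityʳ (x ^ m) ⟨
        x ^ m * 1ℚ     ≤⟨ *-monoˡ (0≤^ m 0≤x) (fromℕ-mono (1≤a 1≤a1 n)) ⟩
        x ^ m * A n    ∎
      ... | yes m≤n with i , refl ← ℕ.m≤n⇒∃[o]m+o≡n m≤n = begin
        x ^ (m ℕ.+ i)           ≡⟨ ^-homo-* x m i ⟩
        x ^ m * x ^ i           ≤⟨ *-mono (0≤^ m 0≤x) (0≤* (0≤^ m 0≤x) (0≤fromℕ (a i))) xᵐ≤A (ih (ℕ.m<n+m i (ℕ.>-nonZero⁻¹ m))) ⟩
        A m * (x ^ m * A i)     ≡⟨ rearrange (A m) (x ^ m) (A i) ⟩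
        x ^ m * (A m * A i)     ≤⟨ *-monoˡ (0≤^ m 0≤x) (A-super m i) ⟩
        x ^ m * A (m ℕ.+ i)     ∎

    -- While n > 2 J the second half has length at least J, so splitting it off loses nothing. The
    -- recursion ends with a first half of length at most 2 J, where H n ≥ 1 and the constant covers
    -- the power of w.
    H-lower : ∀ {w} J → 1 ≤ a 1 → 1ℚ ≤ᵠ w → (∀ n → J ≤ n → w ^ n ≤ᵠ A n) →
              ∀ n → w ^ n ≤ᵠ w ^ (J ℕ.+ J) * H n
    H-lower {w} J 1≤a1 1≤w w≤A = <-rec (λ n → w ^ n ≤ᵠ D * H n) step
      where
      open ≤-Reasoning
      D : ℚ
      D = w ^ (J ℕ.+ J)
      0≤w : 0ℚ ≤ᵠ w
      0≤w = ≤-trans (<⇒≤ 0<1) 1≤w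
      0≤D : 0ℚ ≤ᵠ D
      0≤D = 0≤^ (J ℕ.+ J) 0≤w
      step : ∀ n → (∀ {i} → i ℕ.< n → w ^ i ≤ᵠ D * H i) → w ^ n ≤ᵠ D * H n
      step n ih with n ℕ.≤? J ℕ.+ J
      ... | yes n≤2J = begin
        w ^ n     ≤⟨ ^-mono-exp 1≤w n≤2J ⟩
        D         ≡⟨ *-identityʳ D ⟨
        D * 1ℚ    ≤⟨ *-monoˡ 0≤D (fromℕ-mono (1≤h 1≤a1 n)) ⟩
        D * H n   ∎
      step zero    ih | no n≰2J = ⊥-elim (n≰2J z≤n)
      step (suc n) ih | no n≰2J = begin
        w ^ suc n                ≡⟨ cong (w ^_) (ℕ.⌊n/2⌋+⌈n/2⌉≡n (suc n)) ⟨
        w ^ (l ℕ.+ r)            ≡⟨ ^-homo-* w l r ⟩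
        w ^ l * w ^ r            ≤⟨ *-mono (0≤^ l 0≤w) (0≤fromℕ (a r)) (ih (ℕ.⌊n/2⌋<n n)) (w≤A r J≤r) ⟩
        D * H l * A r            ≡⟨ *-assoc D (H l) (A r) ⟩
        D * (H l * A r)          ≤⟨ *-monoˡ 0≤D (H-halves (suc n)) ⟩
        D * H (suc n)            ∎
        where
        l r : ℕ
        l = ⌊ suc n /2⌋
        r = ⌈ suc n /2⌉
        J≤r : J ≤ r
        J≤r = ℕ.≤-trans (ℕ.≤-reflexive (ℕ.n≡⌈n+n/2⌉ J)) (ℕ.⌈n/2⌉-mono (ℕ.<⇒≤ (ℕ.≰⇒> n≰2J)))

    A-eventually : ∀ {w x} m .{{_ : NonZero m}} → 1 ≤ a 1 → 0ℚ < w → 1ℚ ≤ᵠ x → w < x → x ^ m ≤ᵠ A m →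
                   ∃[ N ] (∀ n → N ≤ n → w ^ n ≤ᵠ A n)
    A-eventually {w} {x} m 1≤a1 0<w 1≤x w<x xᵐ≤A = from-gap (exponential-gap (x ^ m) 0<w w<x)
      where
      from-gap : ∃[ N ] (∀ n → N ≤ n → x ^ m * w ^ n < x ^ n) → ∃[ N ] (∀ n → N ≤ n → w ^ n ≤ᵠ A n)
      from-gap (N , gap) = N , λ n N≤n →
        <⇒≤ (*-cancelˡ-<-nonNeg (x ^ m) {{nonNegative (0≤^ m (≤-trans (<⇒≤ 0<1) 1≤x))}}
          (<-≤-trans (gap n N≤n) (A-lower 1≤a1 1≤x xᵐ≤A n)))

    H-eventually : ∀ {y w} → 1 ≤ a 1 → 1ℚ ≤ᵠ y → y < w → ∃[ N ] (∀ n → N ≤ n → w ^ n ≤ᵠ A n) →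
                   ∃[ N ] (∀ n → N ≤ n → y ^ n < H n)
    H-eventually {y} {w} 1≤a1 1≤y y<w (J , w≤A) = from-gap (exponential-gap D (<-≤-trans 0<1 1≤y) y<w)
      where
      D : ℚ
      D = w ^ (J ℕ.+ J)
      1≤w : 1ℚ ≤ᵠ w
      1≤w = ≤-trans 1≤y (<⇒≤ y<w)
      0≤D : 0ℚ ≤ᵠ D
      0≤D = 0≤^ (J ℕ.+ J) (≤-trans (<⇒≤ 0<1) 1≤w)
      from-gap : ∃[ N ] (∀ n → N ≤ n → D * y ^ n < w ^ n) → ∃[ N ] (∀ n → N ≤ n → y ^ n < H n)
      from-gap (N , gap) = N , λ n N≤n →
        *-cancelˡ-<-nonNeg D {{nonNegative 0≤D}} (<-≤-trans (gap n N≤n) (H-lower J 1≤a1 1≤w w≤A n))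

    -- For y ≥ 1, continuity of the power yields x > y with x ^ m still below A m, and a w between
    -- them provides the two gaps that absorb the constants of `A-lower` and `H-lower`. For y < 1 it
    -- suffices that all H n are at least 1.
    eventually-below : ∀ {y} m .{{_ : NonZero m}} → 0ℚ ≤ᵠ y → y ^ m < A m →
                       ∃[ N ] (∀ n .{{_ : NonZero n}} → N ≤ n → y ^ n < H n)
    eventually-below {y} m 0≤y yᵐ<A = cases (y <? 1ℚ)
      where
      1≤a1 : 1 ≤ a 1
      1≤a1 = 1≤a1-from m 0≤y yᵐ<A
      from-gap : 1ℚ ≤ᵠ y → ∃[ x ] y < x × x ^ m < A m → ∃[ N ] (∀ n → N ≤ n → y ^ n < H n)
      from-gap 1≤y (x , y<x , xᵐ<A) = from-dense (<-dense y<x)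
        where
        from-dense : ∃[ w ] y < w × w < x → ∃[ N ] (∀ n → N ≤ n → y ^ n < H n)
        from-dense (w , y<w , w<x) = H-eventually 1≤a1 1≤y y<w
          (A-eventually m 1≤a1 (<-trans (<-≤-trans 0<1 1≤y) y<w) (≤-trans 1≤y (<⇒≤ y<x)) w<x (<⇒≤ xᵐ<A))
      cases : Dec (y < 1ℚ) → ∃[ N ] (∀ n .{{_ : NonZero n}} → N ≤ n → y ^ n < H n)
      cases (yes y<1) = 0 , λ n _ →
        <-≤-trans (subst (y ^ n <_) (1^ n) (^-mono-< n 0≤y y<1)) (fromℕ-mono (1≤h 1≤a1 n))
      cases (no y≮1) = forget (from-gap (≮⇒≥ y≮1) (^-open-above m 0≤y yᵐ<A))
        where
        forget : ∃[ N ] (∀ n → N ≤ n → y ^ n < H n) → ∃[ N ] (∀ n .{{_ : NonZero n}} → N ≤ n → y ^ n < H n)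
        forget (N , below) = N , λ n → below n

  -- Suprema of cuts and convergence of the roots

  supremum : ExcludedMiddle 0ℓ → (x : ℕ → ℝ) → ∀ b → (∀ n → Upper (x n) b) → ℝ
  supremum em x b bound = record
    { Lower           = Lo
    ; Upper           = Up
    ; lower-inhabited = proj₁ (lower-inhabited (x 0)) , 0 , proj₂ (lower-inhabited (x 0))
    ; upper-inhabited = b + 1ℚ , b , q<q+1 b , λ (n , lo) → disjoint (x n) b (lo , bound n)
    ; lower-rounded   = λ p → mk⇔
        (λ (n , lo) → let q , p<q , lo′ = Equivalence.to (lower-rounded (x n) p) lo in q , p<q , n , lo′)
        (λ (q , p<q , n , lo) → n , Equivalence.from (lower-rounded (x n) p) (q , p<q , lo))
    ; upper-rounded   = λ q → mk⇔
        (λ (p , p<q , ¬lo) → let r , p<r , r<q = <-dense p<q in r , r<q , p , p<r , ¬lo)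
        (λ (r , r<q , p , p<r , ¬lo) → p , <-trans p<r r<q , ¬lo)
    ; disjoint        = λ { q ((n , lo) , p , p<q , ¬lo) →
        ¬lo (n , Equivalence.from (lower-rounded (x n) p) (q , p<q , lo)) }
    ; located         = λ p q p<q → locate p<q em
    }
    where
    Lo Up : ℚ → Set
    Lo q = ∃[ n ] Lower (x n) q
    -- The strict inequality keeps the upper cut rounded: a rational supremum lies outside `Lo` but
    -- must not belong to `Up`.
    Up q = ∃[ p ] p < q × ¬ Lo p
    locate : ∀ {p q} → p < q → Dec (Lo p) → Lo p ⊎ Up q
    locate p<q (yes lo) = inj₁ lo
    locate p<q (no ¬lo) = inj₂ (_ , p<q , ¬lo)

  supremum-upper : (em : ExcludedMiddle 0ℓ) → ∀ x b bound n {q} → Upper (supremum em x b bound) q → Upper (x n) q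
  supremum-upper em x b bound n {q} (p , p<q , ¬lo) with located (x n) p q p<q
  ... | inj₁ lo = ⊥-elim (¬lo (n , lo))
  ... | inj₂ up = up

  -- Starting from a lower point l, steps of δ = ε / 2 are taken until `located` reports l + 2 δ as
  -- an upper point; then q = l + 2 δ and q - ε = l. The Archimedean property bounds the number of
  -- steps.
  approximate : ∀ (x : ℝ) {ε} → 0ℚ < ε → ∃[ q ] Upper x q × Lower x (q - ε)
  approximate x {ε} 0<ε
    with l , lo ← lower-inhabited x
    with u , up ← upper-inhabited x
    = walk (proj₁ (far l u)) l lo (up-closed (proj₂ (far l u)) up)
    where
    δ : ℚ
    δ = ½ * ε
    0<δ : 0ℚ < δ
    0<δ = 0<* (positive⁻¹ ½) 0<ε
    up-closed : ∀ {p q} → p < q → Upper x p → Upper x q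
    up-closed p<q up = Equivalence.from (upper-rounded x _) (_ , p<q , up)
    open +-*-Solver
    far : ∀ l u → ∃[ N ] u < l + fromℕ N * δ
    far l u with N , u-l<Nδ ← archimedean-multiple 0<δ (u - l)
      = N , subst (_< l + fromℕ N * δ) (cancel l u) (+-monoʳ-< l u-l<Nδ)
      where
      cancel : ∀ l u → l + (u - l) ≡ u
      cancel = solve 2 (λ l u → l :+ (u :- l) := u) refl
    walk : ∀ N l → Lower x l → Upper x (l + fromℕ N * δ) → ∃[ q ] Upper x q × Lower x (q - ε)
    walk zero    l lo up = ⊥-elim (disjoint x l (lo , subst (Upper x) (trans (cong (l +_) (*-zeroˡ δ)) (+-identityʳ l)) up))
    walk (suc N) l lo up with located x (l + δ) (l + δ + δ) (subst (_< l + δ + δ) (+-identityʳ (l + δ)) (+-monoʳ-< (l + δ) 0<δ))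
    ... | inj₁ lo′ = walk N (l + δ) lo′ (subst (Upper x) (trans (cong (λ z → l + z * δ) (fromℕ-+ 1 N)) (regroup l (fromℕ N) δ)) up)
      where
      regroup : ∀ l n δ → l + (1ℚ + n) * δ ≡ l + δ + n * δ
      regroup = solve 3 (λ l n δ → l :+ (con 1ℚ :+ n) :* δ := l :+ δ :+ n :* δ) refl
    ... | inj₂ up′ = l + δ + δ , up′ , subst (Lower x) (sym (cancel l ε)) lo
      where
      cancel : ∀ l ε → l + ½ * ε + ½ * ε - ε ≡ l
      cancel = solve 2 (λ l ε → l :+ con ½ :* ε :+ con ½ :* ε :- ε := l) refl

  root-upper-mono : ∀ n .{{_ : NonZero n}} {a b q} → a ≤ b → Upper (root n b) q → Upper (root n a) q
  root-upper-mono n a≤b (0<q , b<qⁿ) = 0<q , ≤-<-trans (fromℕ-mono a≤b) b<qⁿ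

  root-lower-mono : ∀ n .{{_ : NonZero n}} {a b q} → a ≤ b → Lower (root n a) q → Lower (root n b) q
  root-lower-mono n a≤b (inj₁ q<0)  = inj₁ q<0
  root-lower-mono n a≤b (inj₂ qⁿ<a) = inj₂ (<-≤-trans qⁿ<a (fromℕ-mono a≤b))

  module _ (em : ExcludedMiddle 0ℓ) {a h : ℕ → ℕ} (g : Growth a h) where
    open Growth g

    -- The base is raised by 1 because membership in an upper cut is a strict inequality.
    bounded : ∀ n → Upper (root (suc n) (a (suc n))) (fromℕ base + 1ℚ)
    bounded n = ≤-<-trans (0≤fromℕ base) (q<q+1 (fromℕ base)) ,
      ≤-<-trans (≤-trans (fromℕ-mono (a-bound n)) (≤-reflexive (fromℕ-^ base (suc n))))
                (^-mono-< (suc n) (0≤fromℕ base) (q<q+1 (fromℕ base)))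

    growthRate : ℝ
    growthRate = supremum em (λ n → root (suc n) (a (suc n))) (fromℕ base + 1ℚ) bounded

    root≤growthRate : ∀ n .{{_ : NonZero n}} {q} → Upper growthRate q → Upper (root n (a n)) q
    root≤growthRate (suc n) = supremum-upper em (λ n → root (suc n) (a (suc n))) (fromℕ base + 1ℚ) bounded n

    eventually-lower : ∀ {q} → Lower growthRate q →
                       ∃[ N ] (∀ n .{{_ : NonZero n}} → N ≤ n → Lower (root n (h n)) q)
    eventually-lower {q} (m , lo) = cases (q <? 0ℚ) lo
      where
      cases : Dec (q < 0ℚ) → Lower (root (suc m) (a (suc m))) q →
              ∃[ N ] (∀ n .{{_ : NonZero n}} → N ≤ n → Lower (root n (h n)) q)
      cases (yes q<0) _           = 0 , λ n _ → inj₁ q<0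
      cases (no q≮0)  (inj₁ q<0)  = ⊥-elim (q≮0 q<0)
      cases (no q≮0)  (inj₂ qᵐ<a) with N , below ← eventually-below g (suc m) (≮⇒≥ q≮0) qᵐ<a
        = N , λ n N≤n → inj₂ (below n N≤n)

    -- Stated for any sequence between `h` and `a`, so that one argument yields both limits. A
    -- single q serves both halves of the estimate: being above the supremum it bounds every root of
    -- `a`, while q - ε, being below it, is eventually passed by the roots of `h`.
    between-converges : (b : ℕ → ℕ) → (∀ n → h n ≤ b n) → (∀ n → b n ≤ a n) →
                        (λ n → root n (b n)) ⟶ growthRate
    between-converges b h≤b b≤a ε 0<ε = from-approximation (approximate growthRate 0<ε)
      where
      from-approximation : ∃[ q ] Upper growthRate q × Lower growthRate (q - ε) →
                           ∃[ N ] (∀ n .{{_ : NonZero n}} → N ≤ n → ∣ root n (b n) - growthRate ∣< ε)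
      from-approximation (q , up , lo) = from-bound (eventually-lower lo)
        where
        from-bound : ∃[ N ] (∀ n .{{_ : NonZero n}} → N ≤ n → Lower (root n (h n)) (q - ε)) →
                     ∃[ N ] (∀ n .{{_ : NonZero n}} → N ≤ n → ∣ root n (b n) - growthRate ∣< ε)
        from-bound (N , eventually) = N , λ n N≤n →
          (q , root-upper-mono n (b≤a n) (root≤growthRate n up) , lo) ,
          (q , up , root-lower-mono n (h≤b n) (eventually n N≤n))

theorem2p1 : ExcludedMiddle 0ℓ →
    (k : ℕ) → 2 ≤ k →
    (s : SeqLength) (τ : PatternSeq s) →
    (∀ i → SumIndecomposable (perm (τ i))) →
    Σ[ a ∈ (ℕ → ℕ) ] Σ[ h ∈ (ℕ → ℕ) ]
    (∀ n → HasCardinality (Av n τ) (a n)) ×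
    (∀ n → HasCardinality (𝓗 k n τ) (h n)) ×
    (Σ[ L ∈ ℝ ] Σ[ M ∈ ℝ ]
    ((λ n → root n (a n)) ⟶ L) ×
    ((λ n → root n (h n)) ⟶ M) ×
    (L ≃ᴿ M))
theorem2p1 em k 2≤k s τ indec =
  a , h , #Av , #𝓗 , L , L ,
  between-converges em growth a (Growth.h≤a growth) (λ n → ℕ.≤-refl) ,
  between-converges em growth h (λ n → ℕ.≤-refl) (Growth.h≤a growth) ,
  λ q → ⇔-id (Lower L q) , ⇔-id (Upper L q)
  where
  open Counting
  open Cardinalities em k 2≤k τ indec
  open Limits
  L : ℝ
  L = growthRate em growth
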